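{- Let $p$ be a prime with $p\equiv 13, 17, 19$ or $23\pmod{24}$. Then for all integers $n\geq 0$ and all $r\in \{1,\ldots, p-1\}$, $$\sum_{k=-\infty}^\infty (-1)^k a\left(5p^2n+5pr+\frac{25p^2-1}{24}-5k^2\right)\equiv 0\pmod{5}.$$ Here $k$ runs over all integers, and $a(m)=0$ for every integer $m<0$, so the sum is finite.
   Context: For a positive integer $m$ let $f_m := \prod_{j\geq 1}(1-q^{mj})$, where $|q|<1$ (equivalently, as a formal power series in $q$). The integer sequence $a(n)$, $n\ge 0$, is defined by the generating function $$\sum_{n\geq 0} a(n)q^n = \frac{f_2^2}{f_1^3},$$ and is extended by $a(m)=0$ for integers $m<0$. -}

module Defs where

open import Data.Fin.Base as Fin using (Fin; toℕ)
open import Data.Integer.Base as ℤ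
  using (ℤ; +_; -[1+_]; 0ℤ; 1ℤ; -1ℤ; ∣_∣; _+_; _-_; _*_; -_; _^_; -<+)
open import Data.Integer.Properties as ℤₚ using (+-0-monoid)
open import Data.Nat.Base as ℕ using (ℕ; zero; suc; _∸_; NonZero; s≤s)
open import Data.Nat.Properties as ℕₚ using (_≟_)
open import Data.Bool.Base using (if_then_else_)
open import Data.Product.Base using (∃-syntax; _,_)
open import Data.Vec.Base using (Vec; []; _∷_; head; lookup)
open import Relation.Nullary.Decidable using (does; dec-false)
open import Relation.Binary.PropositionalEquality

open import Algebra.Properties.Monoid.Sum +-0-monoid
  using (sum; sum-syntax; sum⁺-syntax; sum-cong-≗; sum-replicate-zero)

-- A formal power series over ℤ is its sequence of coefficients; series are
-- compared pointwise, with _≗_.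

PowerSeries : Set
PowerSeries = ℕ → ℤ

q^_ : ℕ → PowerSeries
(q^ d) n = if does (d ≟ n) then 1ℤ else 0ℤ

𝟙 : PowerSeries
𝟙 = q^ 0

1-q^_ : ℕ → PowerSeries
(1-q^ d) n = 𝟙 n - (q^ d) n

infixl 7 _⊛_
_⊛_ : PowerSeries → PowerSeries → PowerSeries
(F ⊛ G) n = ∑[ i ≤ n ] (F (toℕ i) * G (n ∸ toℕ i))

infixr 8 _^ˢ_
_^ˢ_ : PowerSeries → ℕ → PowerSeries
F ^ˢ zero  = 𝟙
F ^ˢ suc k = F ⊛ F ^ˢ k

-- The inverse G of a series F with constant coefficient 1 is determined by
-- G 0 = 1 and G (n + 1) = − ∑_{i ≤ n} F (i + 1) G (n − i).  The vector
-- inverseCoeffs F n is G n ∷ … ∷ G 0 ∷ [].  If F 0 ≢ 1 the result is junk.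

inverseCoeffs : PowerSeries → (n : ℕ) → Vec ℤ (suc n)
inverseCoeffs F zero    = 1ℤ ∷ []
inverseCoeffs F (suc n) =
  - (∑[ i ≤ n ] (F (suc (toℕ i)) * lookup (inverseCoeffs F n) i))
  ∷ inverseCoeffs F n

infix 9 _⁻¹
_⁻¹ : PowerSeries → PowerSeries
(F ⁻¹) n = head (inverseCoeffs F n)

lookup-inverseCoeffs : ∀ F n (i : Fin (suc n)) →
                       lookup (inverseCoeffs F n) i ≡ (F ⁻¹) (n ∸ toℕ i)
lookup-inverseCoeffs F zero    Fin.zero    = refl
lookup-inverseCoeffs F (suc n) Fin.zero    = refl
lookup-inverseCoeffs F (suc n) (Fin.suc i) = lookup-inverseCoeffs F n i

⁻¹-inverseʳ : ∀ F → F 0 ≡ 1ℤ → F ⊛ F ⁻¹ ≗ 𝟙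
⁻¹-inverseʳ F F0≡1 zero    rewrite F0≡1 = refl
⁻¹-inverseʳ F F0≡1 (suc n) = begin
  F 0 * - S + T  ≡⟨ cong (λ c → c * - S + T) F0≡1 ⟩
  1ℤ * - S + T   ≡⟨ cong (_+ T) (ℤₚ.*-identityˡ (- S)) ⟩
  - S + T        ≡⟨ cong (λ s → - s + T) S≡T ⟩
  - T + T        ≡⟨ ℤₚ.+-inverseˡ T ⟩
  0ℤ             ∎
  where
  open ≡-Reasoning
  S = ∑[ i ≤ n ] (F (suc (toℕ i)) * lookup (inverseCoeffs F n) i)
  T = ∑[ i ≤ n ] (F (suc (toℕ i)) * (F ⁻¹) (n ∸ toℕ i))
  S≡T : S ≡ T
  S≡T = sum-cong-≗ {suc n} λ i →
    cong (F (suc (toℕ i)) *_) (lookup-inverseCoeffs F n i)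

-- ∏_{j = 1}^{N} (1 − q^{mj})

partialProduct : (m N : ℕ) → PowerSeries
partialProduct m zero    = 𝟙
partialProduct m (suc N) = (1-q^ (m ℕ.* suc N)) ⊛ partialProduct m N

-- For m ≥ 1 the factors with j > n do not affect the coefficient of q^n
-- (partialProduct-stable), so the coefficient of q^n in the infinite product
-- is already that of the n-th partial product.

f : ℕ → PowerSeries
f m n = partialProduct m n n

1-q^-⊛-low : ∀ {d n} G → n ℕ.< d → ((1-q^ d) ⊛ G) n ≡ G n
1-q^-⊛-low {d} {n} G n<d = begin
  (1-q^ d) 0 * G n + ∑[ i < n ] ((1-q^ d) (suc (toℕ i)) * G (n ∸ suc (toℕ i)))
    ≡⟨ cong₂ _+_ (cong (_* G n) (coeff0 d n<d)) (sum-cong-≗ vanish) ⟩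
  1ℤ * G n + ∑[ i < n ] 0ℤ
    ≡⟨ cong₂ _+_ (ℤₚ.*-identityˡ (G n)) (sum-replicate-zero n) ⟩
  G n + 0ℤ
    ≡⟨ ℤₚ.+-identityʳ (G n) ⟩
  G n ∎
  where
  open ≡-Reasoning
  coeff0 : ∀ d → n ℕ.< d → (1-q^ d) 0 ≡ 1ℤ
  coeff0 (suc _) _ = refl
  coeff : ∀ i → suc i ℕ.< d → (1-q^ d) (suc i) ≡ 0ℤ
  coeff i i<d rewrite dec-false (d ≟ suc i) (ℕₚ.>⇒≢ i<d) = refl
  vanish : ∀ (i : Fin n) →
           (1-q^ d) (suc (toℕ i)) * G (n ∸ suc (toℕ i)) ≡ 0ℤ
  vanish i = cong (_* G (n ∸ suc (toℕ i)))
    (coeff (toℕ i) (ℕₚ.≤-<-trans (toℕ<n i) n<d))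
    where open import Data.Fin.Properties using (toℕ<n)

partialProduct-stable : ∀ m .{{_ : NonZero m}} n k →
                        partialProduct m (k ℕ.+ n) n ≡ f m n
partialProduct-stable m n zero    = refl
partialProduct-stable m n (suc k) = trans
  (1-q^-⊛-low (partialProduct m (k ℕ.+ n))
    (ℕₚ.≤-trans (s≤s (ℕₚ.m≤n+m n k)) (ℕₚ.m≤n*m (suc (k ℕ.+ n)) m)))
  (partialProduct-stable m n k)

generatingFunction : PowerSeries
generatingFunction = f 2 ^ˢ 2 ⊛ (f 1 ^ˢ 3) ⁻¹

f₁³-invertible : f 1 ^ˢ 3 ⊛ (f 1 ^ˢ 3) ⁻¹ ≗ 𝟙
f₁³-invertible = ⁻¹-inverseʳ (f 1 ^ˢ 3) refl

a : ℤ → ℤ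
a (+ n)    = generatingFunction n
a -[1+ _ ] = 0ℤ

FiniteSupport : (ℤ → ℤ) → Set
FiniteSupport g = ∃[ K ] (∀ k → K ℕ.< ∣ k ∣ → g k ≡ 0ℤ)

-- The sum over all k ∈ ℤ, evaluated as the sum over −K ≤ k ≤ K, where K is
-- the bound outside which the summand is known to vanish.

∑ℤ : (g : ℤ → ℤ) → FiniteSupport g → ℤ
∑ℤ g (K , _) = g 0ℤ + ∑[ j < K ] (g (+ suc (toℕ j)) + g -[1+ toℕ j ])

summand : ℕ → ℤ → ℤ
summand N k = -1ℤ ^ ∣ k ∣ * a (+ N - + 5 * k ^ 2)

a-negative : ∀ {i} → i ℤ.< 0ℤ → a i ≡ 0ℤ
a-negative -<+ = refl

i^2≡∣i∣^2 : ∀ i → i ^ 2 ≡ + (∣ i ∣ ℕ.^ 2)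
i^2≡∣i∣^2 (+ n)    = trans (cong (+ n *_) (ℤₚ.*-identityʳ (+ n)))
  (trans (sym (ℤₚ.pos-* n n)) (cong (λ x → + (n ℕ.* x)) (sym (ℕₚ.*-identityʳ n))))
i^2≡∣i∣^2 -[1+ n ] = trans (cong (-[1+ n ] *_) (ℤₚ.*-identityʳ -[1+ n ]))
  (cong (λ x → + (suc n ℕ.* x)) (sym (ℕₚ.*-identityʳ (suc n))))

summand-finiteSupport : ∀ N → FiniteSupport (summand N)
summand-finiteSupport N = N , λ k N<∣k∣ →
  trans (cong (-1ℤ ^ ∣ k ∣ *_) (a-negative (negative k N<∣k∣)))
        (ℤₚ.*-zeroʳ (-1ℤ ^ ∣ k ∣))
  where
  bound : ∀ m → N ℕ.< m → N ℕ.< 5 ℕ.* m ℕ.^ 2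
  bound m@(suc _) N<m = ℕₚ.<-≤-trans N<m
    (ℕₚ.≤-trans (ℕₚ.m≤m*n m (m ℕ.^ 1) {{ℕₚ.m^n≢0 m 1}}) (ℕₚ.m≤n*m (m ℕ.^ 2) 5))
  negative : ∀ k → N ℕ.< ∣ k ∣ → + N - + 5 * k ^ 2 ℤ.< 0ℤ
  negative k N<∣k∣
    rewrite i^2≡∣i∣^2 k | sym (ℤₚ.pos-* 5 (∣ k ∣ ℕ.^ 2))
    = subst (+ N - M ℤ.<_) (ℤₚ.+-inverseʳ M)
        (ℤₚ.+-monoˡ-< (- M) (ℤ.+<+ (bound ∣ k ∣ N<∣k∣)))
    where M = + (5 ℕ.* ∣ k ∣ ℕ.^ 2)

{-# OPTIONS --safe #-}

-- Write f_m for (q^m; q^m)_∞, T = ∑ (−1)^k q^{k²} and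
-- S = ∑ (6n + 1) q^{n(3n+1)/2}, with k and n running over ℤ.  The sums of the
-- theorem are coefficients of (f₂² / f₁³) T(q⁵) ≡ (f₂² / f₁³) T⁵ (mod 5), and
-- this series is T S, because T = f₁² / f₂ and S = f₁⁵ / f₂².  A term of T S
-- with exponent N satisfies 24 N + 1 = (6n + 1)² + 24 k².  For the N of the
-- theorem p divides 24 N + 1 exactly once, whereas p divides a value of
-- X² + 24 k² only if it divides X and k, as −6 is a non-residue modulo p.
--
-- The formula for T and those of Euler, Gauss and Jacobi for f₁, f₂² / f₁ and
-- f₁³ come from the triple product, and the one for S from them together with
-- S (f₂² / f₁) = f₁ f₁³.  As double theta series both sides of the latter run
-- over the form X² + 3 Y², and they differ by a sign-reversing involution
-- induced by a cube root of unity.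

module Submission where

open import Algebra.Bundles using (CommutativeRing)
open import Algebra.Solver.Ring.AlmostCommutativeRing
  using (fromCommutativeRing; _-Raw-AlmostCommutative⟶_)
open import Data.Integer.Base as ℤ using (ℤ; +_; -[1+_]; ∣_∣; _⊖_; 0ℤ; 1ℤ; -1ℤ)
import Data.Integer.Properties as ℤₚ
open import Data.List.Base using (List; []; _∷_; _++_; map; cartesianProduct)
open import Data.List.Membership.Propositional using (_∈_; _∉_)
open import Data.List.Relation.Unary.Any using (here; there)
open import Data.List.Relation.Unary.AllPairs using ([]; _∷_)
open import Data.List.Relation.Unary.Unique.Propositional using (Unique)
open import Data.Nat.Base as ℕ using (ℕ; zero; suc)
import Data.Nat.Properties as ℕₚ
open import Data.Product.Base using (∃; ∃₂; _×_; _,_; proj₁; proj₂)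
open import Data.Sum.Base using (_⊎_; inj₁; inj₂; [_,_]′)
open import Function.Base using (_∘_)
open import Relation.Nullary using (¬_; yes; no; contradiction)
open import Relation.Binary.PropositionalEquality as ≡ using (_≡_; _≢_)

-- For a given index N all identities are proved in ℤ[[q]] modulo q^(N+1), which is enough because
-- only the coefficient of q^N is read off. There q is nilpotent: infinite sums and products become
-- finite, and the limit in the triple product becomes an equality in any sufficiently long row. The
-- factors 1 - q^n with n ≥ 1, hence the f_m, are units, so quotients such as f₁² / f₂ are never
-- formed; identities are multiplied out and a unit is cancelled at the end. The theta series run
-- over all of ℤ, which counts every term of the classical series for f₂² / f₁ and f₁³ twice. The
-- resulting factors 2, and the sign-reversing involution with its possible fixed points, require
-- that 2 can be cancelled. The prime 5 enters only through T⁵, whose difference from T(q⁵) is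
-- carried along as an explicit multiple of 5. That -6 is a non-residue is shown without quadratic
-- reciprocity, by a descent on the divisors of x² + 6 in which everything about residue classes is
-- a finite check.

-- The non-residue -6 and the form X² + 24 k²

module NonResidue where

  open import Data.Nat
  open import Data.Nat.Coprimality as Coprimality using (Coprime; coprime-divisor; coprime-Bézout)
  open import Data.Nat.DivMod
  open import Data.Nat.Divisibility
  open import Data.Nat.GCD using (module Bézout)
  open import Data.Nat.Induction using (<-rec)
  open import Data.Nat.Primality
  open import Data.Nat.Properties
  open import Data.Nat.Tactic.RingSolver using (solve-∀)
  open import Relation.Nullary using (¬?)
  open import Relation.Nullary.Decidable using (from-yes; _⊎-dec_; _×-dec_; _→-dec_)
  open import Relation.Unary using (Decidable)
  open ≡

  -- −6 is a square modulo the primes in the classes Split modulo 24, but not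
  -- modulo those in the classes Inert.
  Inert : ℕ → Set
  Inert r = r ≡ 13 ⊎ r ≡ 17 ⊎ r ≡ 19 ⊎ r ≡ 23

  Split : ℕ → Set
  Split r = r ≡ 1 ⊎ r ≡ 5 ⊎ r ≡ 7 ⊎ r ≡ 11

  inert? : Decidable Inert
  inert? r = r ≟ 13 ⊎-dec r ≟ 17 ⊎-dec r ≟ 19 ⊎-dec r ≟ 23

  split? : Decidable Split
  split? r = r ≟ 1 ⊎-dec r ≟ 5 ⊎-dec r ≟ 7 ⊎-dec r ≟ 11

  -- `Split` is a subgroup of index 2 in the units modulo 24, the kernel of the quadratic character
  -- of discriminant -24, and `Inert` is its other coset. The table replaces the group theory.
  inert-cofactor : ∀ m k → Inert (m % 24) → Split (m * k % 24) → Inert (k % 24)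
  inert-cofactor m k inert split = table (m%n<n m 24) (m%n<n k 24) inert
    (subst Split (%-distribˡ-* m k 24) split)
    where
    table : ∀ {i} → i < 24 → ∀ {j} → j < 24 → Inert i → Split (i * j % 24) → Inert j
    table = from-yes (allUpTo? (λ i → allUpTo? (λ j →
      inert? i →-dec split? (i * j % 24) →-dec inert? j) 24) 24)

  -- Removing from x² + 6 its common factor g with 6 leaves a number that is
  -- represented by one of the forms of discriminant −24.  Both g and the class
  -- of the cofactor modulo 24 only depend on x modulo 72.
  strip : ∀ x → ∃₂ λ g z → NonZero g × g ∣ 6 × x * x + 6 ≡ g * z × Split (z % 24)
  strip x = lift (table (m%n<n x 72))
    where
    Reduced : ℕ → ℕ → Set
    Reduced s h = suc h ∣ 6 × s * s + 6 ≡ suc h * ((s * s + 6) / suc h)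
                × Split ((s * s + 6) / suc h % 24)
    table : ∀ {s} → s < 72 → ∃ λ h → h < 6 × Reduced s h
    table = from-yes (allUpTo? (λ s → anyUpTo? (λ h →
      suc h ∣? 6 ×-dec s * s + 6 ≟ suc h * ((s * s + 6) / suc h)
                 ×-dec split? ((s * s + 6) / suc h % 24)) 6) 72)
    s = x % 72
    v = x / 72
    -- With x = s + 72 v, x² + 6 exceeds s² + 6 by 6 * 24 * w. Dividing by g ∣ 6 leaves a multiple
    -- of 24, so the class of the cofactor modulo 24 is unchanged.
    w = 36 * v * v + s * v
    lift : (∃ λ h → h < 6 × Reduced s h) →
           ∃₂ λ g z → NonZero g × g ∣ 6 × x * x + 6 ≡ g * z × Split (z % 24)
    lift (h , _ , g∣6@(divides e 6≡eg) , c≡gz , split) =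
      g , z + e * w * 24 , _ , g∣6 , eq , subst Split (sym ([m+kn]%n≡m%n z (e * w) 24)) split
      where
      g = suc h
      z = (s * s + 6) / g
      eq : x * x + 6 ≡ g * (z + e * w * 24)
      eq = begin
        x * x + 6                        ≡⟨ cong (λ y → y * y + 6) (m≡m%n+[m/n]*n x 72) ⟩
        (s + v * 72) * (s + v * 72) + 6  ≡⟨ expand s v ⟩
        (s * s + 6) + 6 * w * 24         ≡⟨ cong₂ (λ c d → c + d * w * 24) c≡gz 6≡eg ⟩
        g * z + e * g * w * 24           ≡⟨ factor g z e w ⟩
        g * (z + e * w * 24)             ∎
        where
        open ≡-Reasoning
        expand : ∀ s v → (s + v * 72) * (s + v * 72) + 6
                       ≡ (s * s + 6) + 6 * (36 * v * v + s * v) * 24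
        expand = solve-∀
        factor : ∀ g z e w → g * z + e * g * w * 24 ≡ g * (z + e * w * 24)
        factor = solve-∀

  coprime-to-6 : ∀ {g} m → Inert (m % 24) → g ∣ 6 → Coprime g m
  coprime-to-6 m inert g∣6 {d} (d∣g , d∣m) = go inert
    where
    d∣6 = ∣-trans d∣g g∣6
    d∣r = %-presˡ-∣ d∣m (∣-trans d∣6 (divides 4 refl))
    conclude : ∀ r → Coprime 6 r → m % 24 ≡ r → d ≡ 1
    conclude r coprime m%24≡r = coprime (d∣6 , subst (d ∣_) m%24≡r d∣r)
    go : Inert (m % 24) → d ≡ 1
    go (inj₁ eq)               = conclude 13 (from-yes (Coprimality.coprime? 6 13)) eq
    go (inj₂ (inj₁ eq))        = conclude 17 (from-yes (Coprimality.coprime? 6 17)) eq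
    go (inj₂ (inj₂ (inj₁ eq))) = conclude 19 (from-yes (Coprimality.coprime? 6 19)) eq
    go (inj₂ (inj₂ (inj₂ eq))) = conclude 23 (from-yes (Coprimality.coprime? 6 23)) eq

  inert≥13 : ∀ m → Inert (m % 24) → 13 ≤ m
  inert≥13 m inert = ≤-trans (go inert) (m%n≤m m 24)
    where
    go : Inert (m % 24) → 13 ≤ m % 24
    go (inj₁ eq)               = ≤-reflexive (sym eq)
    go (inj₂ (inj₁ eq))        = ≤-trans (from-yes (13 ≤? 17)) (≤-reflexive (sym eq))
    go (inj₂ (inj₂ (inj₁ eq))) = ≤-trans (from-yes (13 ≤? 19)) (≤-reflexive (sym eq))
    go (inj₂ (inj₂ (inj₂ eq))) = ≤-trans (from-yes (13 ≤? 23)) (≤-reflexive (sym eq))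

  ∣%²+6 : ∀ m .{{_ : NonZero m}} x → m ∣ x * x + 6 → m ∣ x % m * (x % m) + 6
  ∣%²+6 m x m∣ = m%n≡0⇒n∣m _ m (trans (sym (begin
    (x * x + 6) % m                        ≡⟨ %-distribˡ-+ (x * x) 6 m ⟩
    (x * x % m + 6 % m) % m                ≡⟨ cong (λ c → (c + 6 % m) % m) (%-distribˡ-* x x m) ⟩
    (x % m * (x % m) % m + 6 % m) % m      ≡⟨ %-distribˡ-+ (x % m * (x % m)) 6 m ⟨
    (x % m * (x % m) + 6) % m              ∎)) (n∣m⇒m%n≡0 _ m m∣))
    where open ≡-Reasoning

  -- Infinite descent on m: if m k = x² + 6 with x < m, the part of k prime to 6
  -- is a smaller counterexample.
  inert∤x²+6 : ∀ m → Inert (m % 24) → ∀ x → ¬ m ∣ x * x + 6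
  inert∤x²+6 = <-rec _ descend
    where
    descend : ∀ m → (∀ {k} → k < m → Inert (k % 24) → ∀ x → ¬ k ∣ x * x + 6) →
              Inert (m % 24) → ∀ x → ¬ m ∣ x * x + 6
    descend zero rec inert = contradiction (inert≥13 0 inert) λ ()
    descend m@(suc m-1) rec inert x m∣ = go (strip (x % m)) (∣%²+6 m x m∣)
      where
      go : (∃₂ λ g z → NonZero g × g ∣ 6 × x % m * (x % m) + 6 ≡ g * z × Split (z % 24)) →
           ¬ m ∣ x % m * (x % m) + 6
      go (g , z , g≢0 , g∣6 , eq , split) (divides k eqk)
        -- As g is prime to m, it divides the cofactor k, and `z` equals `m * k′`. A split product
        -- with the inert factor m forces k′ to be inert.
        with divides k′ k≡k′g ← coprime-divisor {o = k} (coprime-to-6 m inert g∣6)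
               (divides z (trans (*-comm m k) (trans (sym eqk) (trans eq (*-comm g z)))))
        = rec k′<m (inert-cofactor m k′ inert (subst (λ c → Split (c % 24)) z≡mk′ split)) (x % m)
            (divides (g * m) (trans eqk (trans (cong (_* m) k≡k′g) (rearrange k′ g m))))
        where
        rearrange : ∀ k′ g m → k′ * g * m ≡ g * m * k′
        rearrange = solve-∀
        z≡mk′ : z ≡ m * k′
        z≡mk′ = *-cancelˡ-≡ z (m * k′) g {{g≢0}}
          (trans (sym eq) (trans eqk (trans (cong (_* m) k≡k′g) (lemma k′ g m))))
          where
          lemma : ∀ k′ g m → k′ * g * m ≡ g * (m * k′)
          lemma = solve-∀
        k′<m : k′ < m
        k′<m = *-cancelʳ-< m k′ m (begin-strict
          k′ * m                  ≤⟨ *-monoˡ-≤ m (m≤m*n k′ g {{g≢0}}) ⟩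
          k′ * g * m              ≡⟨ cong (_* m) k≡k′g ⟨
          k * m                   ≡⟨ eqk ⟨
          x % m * (x % m) + 6     ≤⟨ +-monoˡ-≤ 6 (*-mono-≤ x₀≤m-1 x₀≤m-1) ⟩
          m-1 * m-1 + 6           <⟨ +-monoʳ-< (m-1 * m-1) 6<2m-1 ⟩
          m-1 * m-1 + (m-1 + m)   ≡⟨ square m-1 ⟩
          m * m                   ∎)
          where
          open ≤-Reasoning
          x₀≤m-1 = s≤s⁻¹ (m%n<n x m)
          6<2m-1 : 6 < m-1 + m
          6<2m-1 = ≤-trans (≤-trans (from-yes (7 ≤? 13)) (inert≥13 m inert)) (m≤n+m m m-1)
          square : ∀ n → n * n + (n + suc n) ≡ suc n * suc n
          square = solve-∀

  prime∤⇒coprime : ∀ {p n} → Prime p → ¬ p ∣ n → Coprime p n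
  prime∤⇒coprime p-prime p∤n (d∣p , d∣n) with prime⇒irreducible p-prime d∣p
  ... | inj₁ d≡1  = d≡1
  ... | inj₂ refl = contradiction d∣n p∤n

  -- Otherwise −6 would be a square modulo p.
  inert∣⇒∣ : ∀ p → Prime p → Inert (p % 24) → ∀ X Y → p ∣ X * X + 6 * (Y * Y) → p ∣ Y
  inert∣⇒∣ p p-prime inert X Y p∣ with p ∣? Y
  ... | yes p∣Y = p∣Y
  ... | no  p∤Y with coprime-Bézout (prime∤⇒coprime p-prime p∤Y)
  -- In both Bézout cases v Y ≡ ±1 modulo p, so p divides (X v)² + 6. Here the sign is -1, and
  -- adding 12 u p = 12 (1 + v Y) completes a square without subtraction in ℕ.
  ... | Bézout.+- u v 1+vY≡up = contradiction
    (∣m+n∣m⇒∣n (subst (p ∣_) eq (∣m∣n⇒∣m+n (∣n⇒∣m*n (v * v) p∣) (divides (12 * u) refl)))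
        (divides (6 * u * u * p) refl)) (inert∤x²+6 p inert (X * v))
    where
    eq : v * v * (X * X + 6 * (Y * Y)) + 12 * u * p ≡ 6 * u * u * p * p + (X * v * (X * v) + 6)
    eq = begin
      v * v * (X * X + 6 * (Y * Y)) + 12 * u * p
        ≡⟨ cong (λ c → v * v * (X * X + 6 * (Y * Y)) + c)
            (trans (*-assoc 12 u p) (cong (λ c → 12 * c) (sym 1+vY≡up))) ⟩
      v * v * (X * X + 6 * (Y * Y)) + 12 * (1 + v * Y) ≡⟨ lemma₁ v X Y ⟩
      6 * ((1 + v * Y) * (1 + v * Y)) + (X * v * (X * v) + 6)
        ≡⟨ cong (λ c → 6 * (c * c) + (X * v * (X * v) + 6)) 1+vY≡up ⟩
      6 * (u * p * (u * p)) + (X * v * (X * v) + 6)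
        ≡⟨ cong (_+ (X * v * (X * v) + 6)) (lemma₂ u p) ⟩
      6 * u * u * p * p + (X * v * (X * v) + 6) ∎
      where
      open ≡-Reasoning
      lemma₁ : ∀ v X Y → v * v * (X * X + 6 * (Y * Y)) + 12 * (1 + v * Y)
          ≡ 6 * ((1 + v * Y) * (1 + v * Y)) + (X * v * (X * v) + 6)
      lemma₁ = solve-∀
      lemma₂ : ∀ u p → 6 * (u * p * (u * p)) ≡ 6 * u * u * p * p
      lemma₂ = solve-∀
  ... | Bézout.-+ u v 1+up≡vY = contradiction
    (∣m+n∣m⇒∣n (subst (p ∣_) eq (∣n⇒∣m*n (v * v) p∣)) (divides (12 * u + 6 * u * u * p) refl))
        (inert∤x²+6 p inert (X * v))
    where
    eq : v * v * (X * X + 6 * (Y * Y)) ≡ (12 * u + 6 * u * u * p) * p + (X * v * (X * v) + 6)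
    eq = begin
      v * v * (X * X + 6 * (Y * Y)) ≡⟨ lemma₁ v X Y ⟩
      X * v * (X * v) + 6 * (v * Y * (v * Y))
        ≡⟨ cong (λ c → X * v * (X * v) + 6 * (c * c)) 1+up≡vY ⟨
      X * v * (X * v) + 6 * ((1 + u * p) * (1 + u * p)) ≡⟨ lemma₂ u p (X * v * (X * v)) ⟩
      (12 * u + 6 * u * u * p) * p + (X * v * (X * v) + 6) ∎
      where
      open ≡-Reasoning
      lemma₁ : ∀ v X Y → v * v * (X * X + 6 * (Y * Y)) ≡ X * v * (X * v) + 6 * (v * Y * (v * Y))
      lemma₁ = solve-∀
      lemma₂ : ∀ u p c → c + 6 * ((1 + u * p) * (1 + u * p))
          ≡ (12 * u + 6 * u * u * p) * p + (c + 6)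
      lemma₂ = solve-∀

  -- The only divisors of 120 prime to 6 are 1 and 5, and both are split.
  inert∤120 : ∀ m → Inert (m % 24) → ¬ m ∣ 120
  inert∤120 m inert m∣120 = table (s≤s (∣⇒≤ m∣120)) inert m∣120
    where
    table : ∀ {i} → i < 121 → Inert (i % 24) → ¬ i ∣ 120
    table = from-yes (allUpTo? (λ i → inert? (i % 24) →-dec ¬? (i ∣? 120)) 121)

  -- The left-hand side is 24 N + 1 for the index N of the theorem; p divides it
  -- exactly once, but would divide the right-hand side twice.
  not-represented : ∀ p → Prime p → Inert (p % 24) → ∀ n r → 1 ≤ r → r < p →
    ∀ X k → ¬ (120 * (p * p) * n + 120 * p * r + 25 * (p * p) ≡ X * X + 24 * (k * k))
  not-represented p p-prime inert n r@(suc _) 1≤r r<p X k eq =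
    [ (λ p∣120 → inert∤120 p inert p∣120) , (λ p∣r → >⇒∤ r<p p∣r) ]′
        (euclidsLemma 120 r p-prime p∣120r)
    where
    instance _ = prime⇒nonZero p-prime
    -- Reading 24 k² as 6 Y² with Y = 2 k brings in the form X² + 6 Y² of `inert∣⇒∣`.
    form : ∀ k → 24 * (k * k) ≡ 6 * (2 * k * (2 * k))
    form = solve-∀
    p∣lhs : p ∣ 120 * (p * p) * n + 120 * p * r + 25 * (p * p)
    p∣lhs = divides (120 * p * n + 120 * r + 25 * p) (lemma p n r)
      where
      lemma : ∀ p n r → 120 * (p * p) * n + 120 * p * r + 25 * (p * p)
          ≡ (120 * p * n + 120 * r + 25 * p) * p
      lemma = solve-∀
    p∣rhs = subst (p ∣_) eq p∣lhs
    p>2 : 2 < p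
    p>2 = ≤-trans (from-yes (3 ≤? 13)) (inert≥13 p inert)
    p∣k : p ∣ k
    p∣k = [ (λ p∣2 → contradiction p∣2 (>⇒∤ p>2)) , (λ z → z) ]′ (euclidsLemma 2 k p-prime
      (inert∣⇒∣ p p-prime inert X (2 * k) (subst (λ c → p ∣ X * X + c) (form k) p∣rhs)))
    p∣X : p ∣ X
    p∣X = [ (λ z → z) , (λ z → z) ]′ (euclidsLemma X X p-prime
      (∣m+n∣m⇒∣n (subst (p ∣_) (+-comm (X * X) _) p∣rhs) (∣n⇒∣m*n 24 (∣m⇒∣m*n k p∣k))))
    p²∣lhs : p * p ∣ 120 * (p * p) * n + 120 * p * r + 25 * (p * p)
    p²∣lhs = subst (p * p ∣_) (sym eq)
      (∣m∣n⇒∣m+n (*-pres-∣ p∣X p∣X) (∣n⇒∣m*n 24 (*-pres-∣ p∣k p∣k)))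
    -- Modulo p² the left-hand side is 120 p r, from which one p cancels.
    p∣120r : p ∣ 120 * r
    p∣120r = *-cancelʳ-∣ p (∣m+n∣m⇒∣n (subst (p * p ∣_) (lemma p n r) p²∣lhs)
        (divides (120 * n + 25) refl))
      where
      lemma : ∀ p n r → 120 * (p * p) * n + 120 * p * r + 25 * (p * p)
          ≡ (120 * n + 25) * (p * p) + 120 * r * p
      lemma = solve-∀

-- Exponents and signs of theta terms, and the rotation of X² + 3 Y²

module Exponents where

  open import Algebra.Properties.AbelianGroup ℤₚ.+-0-abelianGroup
    using () renaming (∙-cancelˡ to +-cancelˡ)
  open import Data.Integer.Base using (_+_; _*_; _-_; -_; _^_)
  open import Data.Integer.DivMod using (_/ℕ_; _%ℕ_; a≡a%ℕn+[a/ℕn]*n; n%ℕd<d)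
  open import Data.Integer.Solver using (module +-*-Solver)
  open +-*-Solver using (solve; con; _:=_; _:+_; _:*_; _:-_; :-_)
  open import Data.List.Relation.Unary.All as All using ()
  open import Data.List.Relation.Unary.All.Properties using (¬Any⇒All¬)
  open ≡

  range : ℕ → List ℤ
  range zero    = + 0 ∷ []
  range (suc n) = + suc n ∷ -[1+ n ] ∷ range n

  -- The exponent of ∏ q^(c + d i) over i < n, accumulated as `∏` does it; the closed form would
  -- contain a division by 2.
  quadratic : ℕ → ℕ → ℕ → ℕ
  quadratic c d zero    = 0
  quadratic c d (suc n) = (c ℕ.+ d ℕ.* n) ℕ.+ quadratic c d n

  -- The exponent of q in the k-th term of Ramanujan's f(q^c, q^c′), which is
  -- ((c + c′) k² + (c − c′) k) / 2.
  exponent : ℕ → ℕ → ℤ → ℕ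
  exponent c c′ (+ n)    = quadratic c (c ℕ.+ c′) n
  exponent c c′ -[1+ n ] = quadratic c′ (c ℕ.+ c′) (suc n)

  -- The 1 is needed for c = 0, where the index 1 has exponent 0. It is the reason why the theta
  -- sums run up to N + 1 and not N.
  n≤1+quadratic : ∀ c d .{{_ : ℕ.NonZero d}} n → n ℕ.≤ suc (quadratic c d n)
  n≤1+quadratic c d zero    = ℕ.z≤n
  n≤1+quadratic c d (suc n) = ℕ.s≤s (ℕₚ.≤-trans (ℕₚ.m≤n*m n d)
    (ℕₚ.≤-trans (ℕₚ.m≤n+m _ c) (ℕₚ.m≤m+n _ _)))

  ∣k∣≤1+exponent : ∀ c c′ .{{_ : ℕ.NonZero (c ℕ.+ c′)}} k → ∣ k ∣ ℕ.≤ suc (exponent c c′ k)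
  ∣k∣≤1+exponent c c′ (+ n)    = n≤1+quadratic c (c ℕ.+ c′) n
  ∣k∣≤1+exponent c c′ -[1+ n ] = n≤1+quadratic c′ (c ℕ.+ c′) (suc n)

  -- Near the middle of row 2 n both arguments of the Gaussian binomial are at least N, where it has
  -- reached its limit. The remaining terms of the row vanish with their power of q.
  ⊖-central : ∀ N {a b n} → suc N ℕ.+ suc N ℕ.≤ n → a ℕ.+ b ≡ n ℕ.+ n → ∣ a ⊖ n ∣ ℕ.≤ suc N →
            N ℕ.≤ a × N ℕ.≤ b
  ⊖-central N {a} {b} {n} large a+b≡2n ∣a⊖n∣≤1+N = near n≤1+N+a , near n≤1+N+b
    where
    open ℕₚ.≤-Reasoning
    near : ∀ {m} → n ℕ.≤ suc N ℕ.+ m → N ℕ.≤ m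
    near {m} n≤ = ℕₚ.≤-trans (ℕₚ.n≤1+n N) (ℕₚ.+-cancelˡ-≤ (suc N) (suc N) m (ℕₚ.≤-trans large n≤))
    distance : ∀ {i j} → ∣ i ⊖ j ∣ ℕ.≤ suc N → j ℕ.≤ suc N ℕ.+ i
    distance {i} {j} ∣i⊖j∣≤ with ℕₚ.≤-total i j
    ... | inj₁ i≤j = begin
      j               ≡⟨ ℕₚ.m∸n+n≡m i≤j ⟨
      j ℕ.∸ i ℕ.+ i   ≡⟨ ≡.cong (ℕ._+ i) (ℤₚ.∣⊖∣-≤ i≤j) ⟨
      ∣ i ⊖ j ∣ ℕ.+ i ≤⟨ ℕₚ.+-monoˡ-≤ i ∣i⊖j∣≤ ⟩
      suc N ℕ.+ i     ∎
    ... | inj₂ j≤i = ℕₚ.≤-trans j≤i (ℕₚ.m≤n+m i (suc N))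
    n≤1+N+a = distance ∣a⊖n∣≤1+N
    a≤1+N+n = distance (≡.subst (ℕ._≤ suc N) (ℤₚ.∣m⊖n∣≡∣n⊖m∣ a n) ∣a⊖n∣≤1+N)
    n≤1+N+b : n ℕ.≤ suc N ℕ.+ b
    n≤1+N+b = ℕₚ.+-cancelˡ-≤ n n (suc N ℕ.+ b) (begin
      n ℕ.+ n                ≡⟨ a+b≡2n ⟨
      a ℕ.+ b                ≤⟨ ℕₚ.+-monoˡ-≤ b a≤1+N+n ⟩
      (suc N ℕ.+ n) ℕ.+ b    ≡⟨ ≡.cong (ℕ._+ b) (ℕₚ.+-comm (suc N) n) ⟩
      (n ℕ.+ suc N) ℕ.+ b    ≡⟨ ℕₚ.+-assoc n (suc N) b ⟩
      n ℕ.+ (suc N ℕ.+ b)    ∎)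

  ∈-range⁻ : ∀ n {k} → k ∈ range n → ∣ k ∣ ℕ.≤ n
  ∈-range⁻ zero    (here refl)         = ℕ.z≤n
  ∈-range⁻ (suc n) (here refl)         = ℕₚ.≤-refl
  ∈-range⁻ (suc n) (there (here refl)) = ℕₚ.≤-refl
  ∈-range⁻ (suc n) (there (there k∈))  = ℕₚ.m≤n⇒m≤1+n (∈-range⁻ n k∈)

  ∈-range⁺ : ∀ n k → ∣ k ∣ ℕ.≤ n → k ∈ range n
  ∈-range⁺ zero    (+ zero) _ = here refl
  ∈-range⁺ (suc n) k ∣k∣≤1+n with ℕₚ.m≤n⇒m<n∨m≡n ∣k∣≤1+n
  ... | inj₁ ∣k∣<1+n = there (there (∈-range⁺ n k (ℕ.s≤s⁻¹ ∣k∣<1+n)))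
  ∈-range⁺ (suc n) (+ .(suc n)) _ | inj₂ refl = here refl
  ∈-range⁺ (suc n) -[1+ .n ]    _ | inj₂ refl = there (here refl)

  range-unique : ∀ n → Unique (range n)
  range-unique zero    = All.[] ∷ []
  range-unique (suc n) =
    ((λ ()) All.∷ ¬Any⇒All¬ _ (outside refl)) ∷ ¬Any⇒All¬ _ (outside refl) ∷ range-unique n
    where
    outside : ∀ {k} → ∣ k ∣ ≡ suc n → k ∉ range n
    outside ∣k∣≡1+n k∈ = ℕₚ.1+n≰n (subst (ℕ._≤ n) ∣k∣≡1+n (∈-range⁻ n k∈))

  2*-quadratic : ∀ c d n → + 2 * + quadratic c d n ≡ + d * (+ n * + n) + (+ 2 * + c - + d) * + n
  2*-quadratic c d zero    = solve 2 (λ c d → con (+ 0)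
      := d :* con (+ 0) :+ (con (+ 2) :* c :- d) :* con (+ 0)) refl (+ c) (+ d)
  2*-quadratic c d (suc n) = begin
    + 2 * + ((c ℕ.+ d ℕ.* n) ℕ.+ quadratic c d n)
      ≡⟨ cong (λ z → + 2 * z) (cong (λ z → z + + quadratic c d n)
          (cong (λ z → + c + z) (ℤₚ.pos-* d n))) ⟩
    + 2 * ((+ c + + d * + n) + + quadratic c d n)
      ≡⟨ solve 3 (λ a b r → con (+ 2) :* ((a :+ b) :+ r) := con (+ 2) :* (a :+ b) :+ con (+ 2) :* r)
          refl (+ c) (+ d * + n) _ ⟩
    + 2 * (+ c + + d * + n) + + 2 * + quadratic c d n
      ≡⟨ cong (_+_ (+ 2 * (+ c + + d * + n))) (2*-quadratic c d n) ⟩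
    + 2 * (+ c + + d * + n) + (+ d * (+ n * + n) + (+ 2 * + c - + d) * + n)
      ≡⟨ solve 3 (λ c d n → con (+ 2) :* (c :+ d :* n) :+
          (d :* (n :* n) :+ (con (+ 2) :* c :- d) :* n)
           := d :* ((con (+ 1) :+ n) :* (con (+ 1) :+ n)) :+ (con (+ 2) :* c :- d) :*
               (con (+ 1) :+ n)) refl (+ c) (+ d) (+ n) ⟩
    + d * (+ suc n * + suc n) + (+ 2 * + c - + d) * + suc n ∎
    where open ≡-Reasoning

  2*-exponent : ∀ c c′ k → + 2 * + exponent c c′ k ≡ (+ c + + c′) * (k * k) + (+ c - + c′) * k
  2*-exponent c c′ (+ n)    = trans (2*-quadratic c (c ℕ.+ c′) n)
    (solve 3 (λ c c′ n → (c :+ c′) :* (n :* n) :+ (con (+ 2) :* c :- (c :+ c′)) :* n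
      := (c :+ c′) :* (n :* n) :+ (c :- c′) :* n) refl (+ c) (+ c′) (+ n))
  2*-exponent c c′ -[1+ n ] = trans (2*-quadratic c′ (c ℕ.+ c′) (suc n))
    (solve 3 (λ c c′ n → (c :+ c′) :* (n :* n) :+ (con (+ 2) :* c′ :- (c :+ c′)) :* n
      := (c :+ c′) :* (:- n :* :- n) :+ (c :- c′) :* :- n) refl (+ c) (+ c′) (+ suc n))

  ε : ℤ → ℤ
  ε k = -1ℤ ^ ∣ k ∣

  -1^2m≡1 : ∀ m → -1ℤ ^ (2 ℕ.* m) ≡ 1ℤ
  -1^2m≡1 m = trans (sym (ℤₚ.^-*-assoc -1ℤ 2 m)) (ℤₚ.^-zeroˡ m)

  ε-even : ∀ h → ε (+ 2 * h) ≡ 1ℤ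
  ε-even h = trans (cong (-1ℤ ^_) (ℤₚ.abs-* (+ 2) h)) (-1^2m≡1 ∣ h ∣)

  ε-odd : ∀ h → ε (1ℤ + + 2 * h) ≡ -1ℤ
  ε-odd (+ n)    rewrite sym (ℤₚ.pos-* 2 n) = cong (-1ℤ *_) (-1^2m≡1 n)
  ε-odd -[1+ n ] = trans (cong (-1ℤ ^_) ∣k∣) (cong (-1ℤ *_) (-1^2m≡1 n))
    where
    ∣k∣ : ∣ 1ℤ + + 2 * -[1+ n ] ∣ ≡ suc (2 ℕ.* n)
    ∣k∣ = trans (cong ∣_∣ (solve 1 (λ n → con 1ℤ :+ con (+ 2) :* :- (con 1ℤ :+ n)
        := :- (con 1ℤ :+ con (+ 2) :* n)) refl (+ n)))
      (trans (ℤₚ.∣-i∣≡∣i∣ (1ℤ + + 2 * + n)) (cong (λ i → ∣ 1ℤ + i ∣) (sym (ℤₚ.pos-* 2 n))))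

  parity : ∀ i → (∃ λ h → i ≡ + 2 * h) ⊎ (∃ λ h → i ≡ 1ℤ + + 2 * h)
  parity i with i %ℕ 2 | a≡a%ℕn+[a/ℕn]*n i 2 | n%ℕd<d i 2
  ... | 0 | eq | _ = inj₁ (i /ℕ 2 , trans eq (solve 1 (λ h → con 0ℤ :+ h :* con (+ 2)
      := con (+ 2) :* h) refl (i /ℕ 2)))
  ... | 1 | eq | _ = inj₂ (i /ℕ 2 , trans eq (solve 1 (λ h → con 1ℤ :+ h :* con (+ 2)
      := con 1ℤ :+ con (+ 2) :* h) refl (i /ℕ 2)))
  ... | suc (suc _) | _ | ℕ.s≤s (ℕ.s≤s ())

  even≢odd : ∀ h k → + 2 * h ≢ 1ℤ + + 2 * k
  even≢odd h k eq = contradiction (trans (sym (ε-even h)) (trans (cong ε eq) (ε-odd k))) λ ()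

  ε-parity : ∀ n → (∃ λ h → n ≡ + 2 * h × ε n ≡ 1ℤ) ⊎ (∃ λ h → n ≡ 1ℤ + + 2 * h × ε n ≡ -1ℤ)
  ε-parity n with parity n
  ... | inj₁ (h , refl) = inj₁ (h , refl , ε-even h)
  ... | inj₂ (h , refl) = inj₂ (h , refl , ε-odd h)

  -- With X = 6 n + 1 and Y = 2 j + 1, the norm form X² + 3 Y² of ℤ[√−3] equals
  -- 4 + 24 (exponent 2 1 n + exponent 1 0 j).  If 3 n − j is even, rotate composes
  -- conjugation with multiplication by a cube root of unity,
  -- (X , Y) ↦ ((3 Y − X) / 2 , (X + Y) / 2); if it is odd, this is conjugated by
  -- the reflection Y ↦ − Y.
  rotate-with : ∀ n j → (∃ λ h → + 3 * n - j ≡ + 2 * h) ⊎ (∃ λ h → + 3 * n - j ≡ 1ℤ + + 2 * h)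
      → ℤ × ℤ
  rotate-with n j (inj₁ (h , _)) = n - h , + 3 * n - h
  rotate-with n j (inj₂ (h , _)) = h - + 2 * n , -1ℤ - h

  rotate : ℤ × ℤ → ℤ × ℤ
  rotate (n , j) = rotate-with n j (parity (+ 3 * n - j))

  -- Allows `rotate` to be evaluated at an image of `rotate`, where the half of 3 n - j is known as
  -- a polynomial and not as the quotient that `parity` returns.
  rotate-even : ∀ n j h → + 3 * n - j ≡ + 2 * h → rotate (n , j) ≡ (n - h , + 3 * n - h)
  rotate-even n j h eq with parity (+ 3 * n - j)
  ... | inj₁ (h′ , eq′) rewrite ℤₚ.*-cancelˡ-≡ (+ 2) h′ h (trans (sym eq′) eq) = refl
  ... | inj₂ (h′ , eq′) = contradiction (trans (sym eq) eq′) (even≢odd h h′)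

  rotate-odd : ∀ n j h → + 3 * n - j ≡ 1ℤ + + 2 * h → rotate (n , j) ≡ (h - + 2 * n , -1ℤ - h)
  rotate-odd n j h eq with parity (+ 3 * n - j)
  ... | inj₁ (h′ , eq′) = contradiction (trans (sym eq′) eq) (even≢odd h′ h)
  ... | inj₂ (h′ , eq′)
    rewrite ℤₚ.*-cancelˡ-≡ (+ 2) h′ h (+-cancelˡ 1ℤ _ _ (trans (sym eq′) eq)) = refl

  solve-even : ∀ n j h → + 3 * n - j ≡ + 2 * h → j ≡ + 3 * n - + 2 * h
  solve-even n j h eq = trans (solve 2 (λ n j → j := con (+ 3) :* n :- (con (+ 3) :* n :- j))
      refl n j) (cong (λ z → + 3 * n - z) eq)

  solve-odd : ∀ n j h → + 3 * n - j ≡ 1ℤ + + 2 * h → j ≡ + 3 * n - (1ℤ + + 2 * h)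
  solve-odd n j h eq = trans (solve 2 (λ n j → j := con (+ 3) :* n :- (con (+ 3) :* n :- j))
      refl n j) (cong (λ z → + 3 * n - z) eq)

  -- `rotate` preserves the parity of 3 n - j, so its second application takes the same branch. Here
  -- h becomes - h; in `odd-image` it becomes 2 h - 3 n.
  even-image : ∀ n h → + 3 * (n - h) - (+ 3 * n - h) ≡ + 2 * - h
  even-image = solve 2 (λ n h → con (+ 3) :* (n :- h) :- (con (+ 3) :* n :- h)
      := con (+ 2) :* :- h) refl

  odd-image : ∀ n h → + 3 * (h - + 2 * n) - (-1ℤ - h) ≡ 1ℤ + + 2 * (+ 2 * h - + 3 * n)
  odd-image = solve 2 (λ n h → con (+ 3) :* (h :- con (+ 2) :* n) :- (con -1ℤ :- h)
    := con 1ℤ :+ con (+ 2) :* (con (+ 2) :* h :- con (+ 3) :* n)) refl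

  rotate-involutive : ∀ u → rotate (rotate u) ≡ u
  rotate-involutive (n , j) with parity (+ 3 * n - j)
  ... | inj₁ (h , eq) = trans (rotate-even (n - h) (+ 3 * n - h) (- h) (even-image n h)) (cong₂ _,_
    (solve 2 (λ n h → (n :- h) :- :- h := n) refl n h)
    (trans (solve 2 (λ n h → con (+ 3) :* (n :- h) :- :- h := con (+ 3) :* n :- con (+ 2) :* h)
        refl n h)
           (sym (solve-even n j h eq))))
  ... | inj₂ (h , eq) = trans (rotate-odd (h - + 2 * n) (-1ℤ - h) (+ 2 * h - + 3 * n)
      (odd-image n h)) (cong₂ _,_
    (solve 2 (λ n h → (con (+ 2) :* h :- con (+ 3) :* n) :- con (+ 2) :* (h :- con (+ 2) :* n) := n)
        refl n h)
    (trans (solve 2 (λ n h → con -1ℤ :- (con (+ 2) :* h :- con (+ 3) :* n)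
        := con (+ 3) :* n :- (con 1ℤ :+ con (+ 2) :* h)) refl n h)
           (sym (solve-odd n j h eq))))

  -- The coefficient at (n , j) of the difference of the two double series in `θ-rotation`. The sign
  -- ε n ε j depends on the parity of 3 n - j, so the weight is X - Y on the even branch and X + Y
  -- on the odd one.
  rotationWeight : ℤ × ℤ → ℤ
  rotationWeight (n , j) = (+ 6 * n + 1ℤ) - (ε n * ε j) * (+ 2 * j + 1ℤ)

  ε*ε-even : ∀ n h → ε n * ε (+ 3 * n - + 2 * h) ≡ 1ℤ
  ε*ε-even n h with ε-parity n
  ... | inj₁ (m , refl , εn) = cong₂ _*_ εn (trans (cong ε
    (solve 2 (λ m h → con (+ 3) :* (con (+ 2) :* m) :- con (+ 2) :* h
        := con (+ 2) :* (con (+ 3) :* m :- h)) refl m h)) (ε-even (+ 3 * m - h)))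
  ... | inj₂ (m , refl , εn) = cong₂ _*_ εn (trans (cong ε
    (solve 2 (λ m h → con (+ 3) :* (con 1ℤ :+ con (+ 2) :* m) :- con (+ 2) :* h := con 1ℤ :+
        con (+ 2) :* (con 1ℤ :+ con (+ 3) :* m :- h)) refl m h)) (ε-odd (1ℤ + + 3 * m - h)))

  ε*ε-odd : ∀ n h → ε n * ε (+ 3 * n - (1ℤ + + 2 * h)) ≡ -1ℤ
  ε*ε-odd n h with ε-parity n
  ... | inj₁ (m , refl , εn) = cong₂ _*_ εn (trans (cong ε
    (solve 2 (λ m h → con (+ 3) :* (con (+ 2) :* m) :- (con 1ℤ :+ con (+ 2) :* h) := con 1ℤ :+
        con (+ 2) :* (con (+ 3) :* m :- h :- con 1ℤ)) refl m h)) (ε-odd (+ 3 * m - h - 1ℤ)))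
  ... | inj₂ (m , refl , εn) = cong₂ _*_ εn (trans (cong ε
    (solve 2 (λ m h → con (+ 3) :* (con 1ℤ :+ con (+ 2) :* m) :- (con 1ℤ :+ con (+ 2) :* h)
        := con (+ 2) :* (con 1ℤ :+ con (+ 3) :* m :- h)) refl m h)) (ε-even (1ℤ + + 3 * m - h)))

  rotationWeight-even : ∀ n j h → + 3 * n - j ≡ + 2 * h → rotationWeight (n , j) ≡ + 4 * h
  rotationWeight-even n j h eq rewrite solve-even n j h eq | ε*ε-even n h =
    solve 2 (λ n h → (con (+ 6) :* n :+ con 1ℤ) :- con 1ℤ :*
        (con (+ 2) :* (con (+ 3) :* n :- con (+ 2) :* h) :+ con 1ℤ) := con (+ 4) :* h) refl n h

  rotationWeight-odd : ∀ n j h → + 3 * n - j ≡ 1ℤ + + 2 * h → rotationWeight (n , j)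
      ≡ + 12 * n - + 4 * h
  rotationWeight-odd n j h eq rewrite solve-odd n j h eq | ε*ε-odd n h =
    solve 2 (λ n h → (con (+ 6) :* n :+ con 1ℤ) :- con -1ℤ :*
        (con (+ 2) :* (con (+ 3) :* n :- (con 1ℤ :+ con (+ 2) :* h)) :+ con 1ℤ)
            := con (+ 12) :* n :- con (+ 4) :* h) refl n h

  -- On the even branch (3 Y - X) / 2 - (X + Y) / 2 = - (X - Y). The odd branch is the reflection of
  -- this in Y ↦ - Y, with X + Y in place of X - Y.
  rotationWeight-rotate : ∀ u → rotationWeight (rotate u) ≡ - rotationWeight u
  rotationWeight-rotate (n , j) with parity (+ 3 * n - j)
  ... | inj₁ (h , eq) = trans (rotationWeight-even (n - h) (+ 3 * n - h) (- h) (even-image n h))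
    (trans (sym (ℤₚ.neg-distribʳ-* (+ 4) h)) (cong -_ (sym (rotationWeight-even n j h eq))))
  ... | inj₂ (h , eq) = trans (rotationWeight-odd (h - + 2 * n) (-1ℤ - h) (+ 2 * h - + 3 * n)
      (odd-image n h))
    (trans (solve 2 (λ n h → con (+ 12) :* (h :- con (+ 2) :* n) :- con (+ 4) :*
        (con (+ 2) :* h :- con (+ 3) :* n)
              := :- (con (+ 12) :* n :- con (+ 4) :* h)) refl n h)
           (cong -_ (sym (rotationWeight-odd n j h eq))))

  rotationExponent : ℤ × ℤ → ℕ
  rotationExponent (n , j) = exponent 2 1 n ℕ.+ exponent 1 0 j

  2*-rotationExponent : ∀ n j → + 2 * + rotationExponent (n , j) ≡ + 3 * (n * n) + n + (j * j + j)
  2*-rotationExponent n j = begin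
    + 2 * (+ exponent 2 1 n + + exponent 1 0 j)
      ≡⟨ ℤₚ.*-distribˡ-+ (+ 2) (+ exponent 2 1 n) (+ exponent 1 0 j) ⟩
    + 2 * + exponent 2 1 n + + 2 * + exponent 1 0 j
      ≡⟨ cong₂ _+_ (2*-exponent 2 1 n) (2*-exponent 1 0 j) ⟩
    (+ 3 * (n * n) + 1ℤ * n) + (1ℤ * (j * j) + 1ℤ * j)
      ≡⟨ solve 2 (λ n j → (con (+ 3) :* (n :* n) :+ con 1ℤ :* n) :+
          (con 1ℤ :* (j :* j) :+ con 1ℤ :* j)
           := con (+ 3) :* (n :* n) :+ n :+ (j :* j :+ j)) refl n j ⟩
    + 3 * (n * n) + n + (j * j + j)                      ∎
    where open ≡-Reasoning

  -- Conjugation and multiplication by a root of unity preserve the norm. The doubled exponent is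
  -- compared because it is an integral polynomial.
  rotationExponent-rotate : ∀ u → rotationExponent (rotate u) ≡ rotationExponent u
  rotationExponent-rotate u@(n , j) = ℤₚ.+-injective (ℤₚ.*-cancelˡ-≡ (+ 2) _ _
    (trans (2*-rotationExponent (proj₁ (rotate u)) (proj₂ (rotate u)))
        (trans norm (sym (2*-rotationExponent n j)))))
    where
    form : ℤ × ℤ → ℤ
    form (n , j) = + 3 * (n * n) + n + (j * j + j)
    norm : form (rotate u) ≡ form u
    norm with parity (+ 3 * n - j)
    ... | inj₁ (h , eq) rewrite solve-even n j h eq = solve 2 (λ n h →
      con (+ 3) :* ((n :- h) :* (n :- h)) :+ (n :- h) :+
          ((con (+ 3) :* n :- h) :* (con (+ 3) :* n :- h) :+ (con (+ 3) :* n :- h))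
      := con (+ 3) :* (n :* n) :+ n :+
          ((con (+ 3) :* n :- con (+ 2) :* h) :* (con (+ 3) :* n :- con (+ 2) :* h) :+
              (con (+ 3) :* n :- con (+ 2) :* h))) refl n h
    ... | inj₂ (h , eq) rewrite solve-odd n j h eq = solve 2 (λ n h →
      con (+ 3) :* ((h :- con (+ 2) :* n) :* (h :- con (+ 2) :* n)) :+ (h :- con (+ 2) :* n) :+
          ((con -1ℤ :- h) :* (con -1ℤ :- h) :+ (con -1ℤ :- h))
      := con (+ 3) :* (n :* n) :+ n :+
          ((con (+ 3) :* n :- (con 1ℤ :+ con (+ 2) :* h)) :*
              (con (+ 3) :* n :- (con 1ℤ :+ con (+ 2) :* h)) :+
                  (con (+ 3) :* n :- (con 1ℤ :+ con (+ 2) :* h)))) refl n h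

  2[a⊖1+b]+1 : ∀ a b → + 2 * (a ⊖ suc b) + 1ℤ ≡ (+ 2 * (a ⊖ b) + 1ℤ) + - + 2
  2[a⊖1+b]+1 a b = trans
    (cong (λ k → + 2 * k + 1ℤ) (trans (cong (λ m → a ⊖ suc m) (sym (ℕₚ.+-identityʳ b)))
        (sym (ℤₚ.distribˡ-⊖-+-neg 0 a b))))
    (solve 1 (λ k → con (+ 2) :* (k :+ con -1ℤ) :+ con 1ℤ
        := (con (+ 2) :* k :+ con 1ℤ) :+ con (- + 2)) refl (a ⊖ b))

  i*i≡+∣i∣*∣i∣ : ∀ i → i * i ≡ + (∣ i ∣ ℕ.* ∣ i ∣)
  i*i≡+∣i∣*∣i∣ (+ n)    = sym (ℤₚ.pos-* n n)
  i*i≡+∣i∣*∣i∣ -[1+ n ] = refl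

  exponents-norm : ∀ k n → 24 ℕ.* (exponent 1 1 k ℕ.+ exponent 2 1 n) ℕ.+ 1 ≡
                   ∣ + 6 * n + 1ℤ ∣ ℕ.* ∣ + 6 * n + 1ℤ ∣ ℕ.+ 24 ℕ.* (∣ k ∣ ℕ.* ∣ k ∣)
  exponents-norm k n = ℤₚ.+-injective (begin
    + (24 ℕ.* (e ℕ.+ e′)) + 1ℤ                 ≡⟨ cong (λ z → z + 1ℤ) (ℤₚ.pos-* 24 (e ℕ.+ e′)) ⟩
    + 24 * (+ e + + e′) + 1ℤ
      ≡⟨ solve 2 (λ e e′ → con (+ 24) :* (e :+ e′) :+ con 1ℤ := con (+ 12) :* (con (+ 2) :* e) :+
          con (+ 12) :* (con (+ 2) :* e′) :+ con 1ℤ) refl (+ e) (+ e′) ⟩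
    + 12 * (+ 2 * + e) + + 12 * (+ 2 * + e′) + 1ℤ
      ≡⟨ cong₂ (λ x y → + 12 * x + + 12 * y + 1ℤ) (2*-exponent 1 1 k) (2*-exponent 2 1 n) ⟩
    + 12 * (+ 2 * (k * k) + 0ℤ * k) + + 12 * (+ 3 * (n * n) + 1ℤ * n) + 1ℤ
      ≡⟨ solve 2 (λ k n → con (+ 12) :* (con (+ 2) :* (k :* k) :+ con 0ℤ :* k) :+ con (+ 12) :*
          (con (+ 3) :* (n :* n) :+ con 1ℤ :* n) :+ con 1ℤ
           := (con (+ 6) :* n :+ con 1ℤ) :* (con (+ 6) :* n :+ con 1ℤ) :+ con (+ 24) :* (k :* k))
               refl k n ⟩
    X * X + + 24 * (k * k)
      ≡⟨ cong₂ (λ x y → x + + 24 * y) (i*i≡+∣i∣*∣i∣ X) (i*i≡+∣i∣*∣i∣ k) ⟩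
    + (∣ X ∣ ℕ.* ∣ X ∣) + + 24 * + (∣ k ∣ ℕ.* ∣ k ∣)
      ≡⟨ cong (_+_ (+ (∣ X ∣ ℕ.* ∣ X ∣))) (ℤₚ.pos-* 24 (∣ k ∣ ℕ.* ∣ k ∣)) ⟨
    + (∣ X ∣ ℕ.* ∣ X ∣ ℕ.+ 24 ℕ.* (∣ k ∣ ℕ.* ∣ k ∣)) ∎)
    where
    open ≡-Reasoning
    e = exponent 1 1 k
    e′ = exponent 2 1 n
    X = + 6 * n + 1ℤ

-- Theta identities over a commutative ring: antidiagonal sums and products

module ThetaIdentities {c ℓ} (R : CommutativeRing c ℓ)
  (ι-homo : ℤ.+-*-rawRing -Raw-AlmostCommutative⟶ fromCommutativeRing R) where

  open import Data.List.Membership.Propositional.Properties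
    using (∈-∃++; ∈-map⁺; ∈-cartesianProduct⁺)
  open import Data.List.Relation.Binary.Permutation.Propositional
    using (_↭_; prep; swap; ↭-sym; ↭⇒↭ₛ) renaming (refl to ↭-refl; trans to ↭-tr)
  open import Data.List.Relation.Binary.Permutation.Propositional.Properties using (shift; ∈-resp-↭)
  import Data.List.Relation.Binary.Permutation.Setoid.Properties as ↭ₛ
  import Data.List.Relation.Unary.Unique.Propositional.Properties as Unique
  import Data.Maybe.Base as Maybe
  open import Data.Nat.Tactic.RingSolver using (solve-∀)
  open import Relation.Nullary.Decidable using (dec⇒maybe)
  import Algebra.Solver.Ring

  open CommutativeRing R hiding (zero)
  open _-Raw-AlmostCommutative⟶_ ι-homo renaming (⟦_⟧ to ι)
  open import Algebra.Properties.CommutativeSemiring.Exp commutativeSemiring using (^-distrib-*)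
  open import Algebra.Properties.Ring ring using (-0#≈0#; -1*x≈-x; -‿distribˡ-*)
  open import Algebra.Properties.Semiring.Exp semiring
  open import Relation.Binary.Reasoning.Setoid setoid
  open Exponents

  ι-cong : ∀ {i j} → i ≡ j → ι i ≈ ι j
  ι-cong ≡.refl = refl

  module Solver = Algebra.Solver.Ring ℤ.+-*-rawRing (fromCommutativeRing R) ι-homo
    (λ i j → Maybe.map ι-cong (dec⇒maybe (i ℤₚ.≟ j)))
  open Solver using (solve; Polynomial; con; _:=_; _:+_; _:*_; _:-_; :-_; _:^_)

  -- Unlike con (+ 1), this evaluates to 1# definitionally.
  :1 : ∀ {n} → Polynomial n
  :1 = con (+ 0) :^ 0

  -- Rows of the Gaussian Pascal triangle are summed over pairs (a , b), which avoids subtraction in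
  -- ℕ.
  antidiagonal : (ℕ → ℕ → Carrier) → ℕ → Carrier
  antidiagonal f zero    = f 0 0
  antidiagonal f (suc m) = f 0 (suc m) + antidiagonal (f ∘ suc) m

  antidiagonal-cong : ∀ {f g} m → (∀ a b → a ℕ.+ b ≡ m → f a b ≈ g a b) →
                      antidiagonal f m ≈ antidiagonal g m
  antidiagonal-cong zero    f≈g = f≈g 0 0 ≡.refl
  antidiagonal-cong (suc m) f≈g = +-cong (f≈g 0 (suc m) ≡.refl)
    (antidiagonal-cong m λ a b a+b≡m → f≈g (suc a) b (≡.cong suc a+b≡m))

  antidiagonal-+ : ∀ f g m → antidiagonal (λ a b → f a b + g a b) m ≈
                             antidiagonal f m + antidiagonal g m
  antidiagonal-+ f g zero    = refl
  antidiagonal-+ f g (suc m) = trans (+-congˡ (antidiagonal-+ (f ∘ suc) (g ∘ suc) m))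
    (solve 4 (λ a b c d → (a :+ b) :+ (c :+ d) := (a :+ c) :+ (b :+ d)) refl _ _ _ _)

  antidiagonal-* : ∀ r f m → antidiagonal (λ a b → r * f a b) m ≈ r * antidiagonal f m
  antidiagonal-* r f zero    = refl
  antidiagonal-* r f (suc m) =
    trans (+-congˡ (antidiagonal-* r (f ∘ suc) m)) (sym (distribˡ r _ _))

  -- The generality in c is only needed for the induction.
  antidiagonal-pascal : ∀ {h u v} {c : ℕ → Carrier} m →
    (∀ b → h 0 (suc b) ≈ u 0 b + c b) →
    (∀ a → h (suc a) 0 ≈ v a 0) →
    (∀ a b → h (suc a) (suc b) ≈ u (suc a) b + v a (suc b)) →
    antidiagonal h (suc m) ≈ (antidiagonal u m + antidiagonal v m) + c m
  antidiagonal-pascal {h} {u} {v} {c} zero left right inner = begin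
    h 0 1 + h 1 0              ≈⟨ +-cong (left 0) (right 0) ⟩
    (u 0 0 + c 0) + v 0 0      ≈⟨ solve 3 (λ a b c → (a :+ b) :+ c := (a :+ c) :+ b) refl _ _ _ ⟩
    (u 0 0 + v 0 0) + c 0      ∎
  antidiagonal-pascal {h} {u} {v} {c} (suc m) left right inner = begin
    h 0 (suc (suc m)) + antidiagonal (h ∘ suc) (suc m)
      ≈⟨ +-cong (left (suc m)) (antidiagonal-pascal {h ∘ suc} {u ∘ suc} {v ∘ suc} m (inner 0)
          (right ∘ suc) (inner ∘ suc)) ⟩
    (u 0 (suc m) + c (suc m)) + ((antidiagonal (u ∘ suc) m + antidiagonal (v ∘ suc) m) + v 0
        (suc m))
      ≈⟨ solve 5 (λ a b c d e → (a :+ b) :+ ((c :+ d) :+ e) := ((a :+ c) :+ (e :+ d)) :+ b)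
          refl _ _ _ _ _ ⟩
    (antidiagonal u (suc m) + antidiagonal v (suc m)) + c (suc m) ∎

  ∏ : (ℕ → Carrier) → ℕ → Carrier
  ∏ f zero    = 1#
  ∏ f (suc n) = f n * ∏ f n

  ∏-cong : ∀ {f g} n → (∀ i → f i ≈ g i) → ∏ f n ≈ ∏ g n
  ∏-cong zero    f≈g = refl
  ∏-cong (suc n) f≈g = *-cong (f≈g n) (∏-cong n f≈g)

  -- Gaussian binomial coefficients

  module QBinomial (Q : Carrier) where

    -- qbinomial a b is the Gaussian binomial coefficient [a + b choose a].
    qbinomial : ℕ → ℕ → Carrier
    qbinomial zero    b       = 1#
    qbinomial (suc a) zero    = 1#
    qbinomial (suc a) (suc b) = qbinomial (suc a) b + Q ^ suc b * qbinomial a (suc b)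

    qbinomial-0ʳ : ∀ a → qbinomial a 0 ≈ 1#
    qbinomial-0ʳ zero    = refl
    qbinomial-0ʳ (suc a) = refl

    -- Neighbouring entries of one row. As 1 - Q^k need not be invertible, this relation does the
    -- work of the quotient formula.
    qbinomial-ratio : ∀ a b → (1# - Q ^ suc a) * qbinomial (suc a) b ≈
                              (1# - Q ^ suc b) * qbinomial a (suc b)
    qbinomial-ratio zero zero = refl
    qbinomial-ratio zero (suc b) = begin
      (1# - Q ^ 1) * (qbinomial 1 b + Q ^ suc b * 1#)
        ≈⟨ solve 3 (λ q g r → (:1 :- q) :* (g :+ r :* :1)
             := (:1 :- q) :* g :+ (r :- q :* r)) refl _ _ _ ⟩
      (1# - Q ^ 1) * qbinomial 1 b + (Q ^ suc b - Q ^ 1 * Q ^ suc b)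
        ≈⟨ +-congʳ (qbinomial-ratio zero b) ⟩
      (1# - Q ^ suc b) * 1# + (Q ^ suc b - Q ^ 1 * Q ^ suc b)
        ≈⟨ solve 2 (λ q r → (:1 :- r) :* :1 :+ (r :- q :* :1 :* r)
             := (:1 :- q :* r) :* :1) refl _ _ ⟩
      (1# - Q ^ suc (suc b)) * 1# ∎
    qbinomial-ratio (suc a) zero = begin
      (1# - Q ^ suc (suc a)) * 1#
        ≈⟨ solve 2 (λ q r → (:1 :- q :* r) :* :1
             := (:1 :- q :* :1) :* :1 :+ q :* :1 :* ((:1 :- r) :* :1)) refl _ _ ⟩
      (1# - Q ^ 1) * 1# + Q ^ 1 * ((1# - Q ^ suc a) * 1#)
        ≈⟨ +-congˡ (*-congˡ (qbinomial-ratio a zero)) ⟩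
      (1# - Q ^ 1) * 1# + Q ^ 1 * ((1# - Q ^ 1) * qbinomial a 1)
        ≈⟨ solve 2 (λ q g → (:1 :- q) :* :1 :+ q :* ((:1 :- q) :* g)
             := (:1 :- q) :* (:1 :+ q :* g)) refl _ _ ⟩
      (1# - Q ^ 1) * (1# + Q ^ 1 * qbinomial a 1) ∎
    qbinomial-ratio (suc a) (suc b) = begin
      (1# - Q ^ suc (suc a)) * (qbinomial (suc (suc a)) b + Q ^ suc b * g)
        ≈⟨ distribˡ _ _ _ ⟩
      (1# - Q ^ suc (suc a)) * qbinomial (suc (suc a)) b + (1# - Q ^ suc (suc a)) * (Q ^ suc b * g)
        ≈⟨ +-congʳ (qbinomial-ratio (suc a) b) ⟩
      (1# - Q ^ suc b) * g + (1# - Q ^ suc (suc a)) * (Q ^ suc b * g)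
        ≈⟨ solve 4 (λ q r s g → (:1 :- s) :* g :+ (:1 :- q :* r) :* (s :* g)
             := (:1 :- q :* s) :* g :+ q :* s :* ((:1 :- r) :* g)) refl _ _ _ _ ⟩
      (1# - Q ^ suc (suc b)) * g + Q ^ suc (suc b) * ((1# - Q ^ suc a) * g)
        ≈⟨ +-congˡ (*-congˡ (qbinomial-ratio a (suc b))) ⟩
      (1# - Q ^ suc (suc b)) * g + Q ^ suc (suc b) *
          ((1# - Q ^ suc (suc b)) * qbinomial a (suc (suc b)))
        ≈⟨ solve 3 (λ s g h → (:1 :- s) :* g :+ s :* ((:1 :- s) :* h)
             := (:1 :- s) :* (g :+ s :* h)) refl _ _ _ ⟩
      (1# - Q ^ suc (suc b)) * qbinomial (suc a) (suc (suc b)) ∎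
      where g = qbinomial (suc a) (suc b)

    -- The definition contains one of the two q-Pascal rules, and the ratio of neighbours yields the
    -- other. The triple product needs the first to raise A and this one to raise B.
    qbinomial-pascal : ∀ a b → qbinomial (suc a) (suc b) ≈
                               qbinomial a (suc b) + Q ^ suc a * qbinomial (suc a) b
    qbinomial-pascal a b = begin
      g + Q ^ suc b * h
        ≈⟨ solve 4 (λ r s g h → g :+ s :* h := (:1 :- r) :* g :+ (r :* g :+ s :* h)) refl _ _ _ _ ⟩
      (1# - Q ^ suc a) * g + (Q ^ suc a * g + Q ^ suc b * h)
        ≈⟨ +-congʳ (qbinomial-ratio a b) ⟩
      (1# - Q ^ suc b) * h + (Q ^ suc a * g + Q ^ suc b * h)
        ≈⟨ solve 4 (λ r s g h → (:1 :- s) :* h :+ (r :* g :+ s :* h) := h :+ r :* g) refl _ _ _ _ ⟩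
      h + Q ^ suc a * g ∎
      where
      g = qbinomial (suc a) b
      h = qbinomial a (suc b)

    pochhammer : ℕ → Carrier
    pochhammer = ∏ (λ i → 1# - Q ^ suc i)

    qbinomial-pochhammer : ∀ a b → qbinomial a b * (pochhammer a * pochhammer b)
        ≈ pochhammer (a ℕ.+ b)
    qbinomial-pochhammer zero b = solve 1 (λ p → :1 :* (:1 :* p) := p) refl _
    qbinomial-pochhammer (suc a) zero =
      trans (solve 1 (λ p → :1 :* (p :* :1) := p) refl _)
        (reflexive (≡.cong pochhammer (≡.sym (ℕₚ.+-identityʳ (suc a)))))
    qbinomial-pochhammer (suc a) (suc b) = begin
      (g + Q ^ suc b * h) * (((1# - Q ^ suc a) * p) * ((1# - Q ^ suc b) * p′))
        ≈⟨ solve 6 (λ r s g h p p′ → (g :+ s :* h) :* (((:1 :- r) :* p) :* ((:1 :- s) :* p′))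
           := (:1 :- s) :* (g :* (((:1 :- r) :* p) :* p′)) :+ s :* (:1 :- r) :*
               (h :* (p :* ((:1 :- s) :* p′)))) refl _ _ _ _ _ _ ⟩
      (1# - Q ^ suc b) * (g * (pochhammer (suc a) * p′)) + Q ^ suc b * (1# - Q ^ suc a) *
          (h * (p * pochhammer (suc b)))
        ≈⟨ +-cong (*-congˡ (trans (qbinomial-pochhammer (suc a) b)
            (reflexive (≡.cong pochhammer (≡.sym (ℕₚ.+-suc a b))))))
                  (*-congˡ (qbinomial-pochhammer a (suc b))) ⟩
      (1# - Q ^ suc b) * P + Q ^ suc b * (1# - Q ^ suc a) * P
        ≈⟨ solve 3 (λ r s P → (:1 :- s) :* P :+ s :* (:1 :- r) :* P := (:1 :- r :* s) :* P)
            refl _ _ _ ⟩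
      (1# - Q ^ suc a * Q ^ suc b) * P
        ≈⟨ *-congʳ (+-congˡ (-‿cong (sym (^-homo-* Q (suc a) (suc b))))) ⟩
      pochhammer (suc a ℕ.+ suc b) ∎
      where
      g = qbinomial (suc a) b
      h = qbinomial a (suc b)
      p = pochhammer a
      p′ = pochhammer b
      P = pochhammer (a ℕ.+ suc b)

  -- The finite triple product and its derivative

  module TripleProduct (x y : Carrier) where

    Q = x * y

    open QBinomial Q public

    -- The term of Ramanujan's theta function f(x, y) of index a − B.
    term : ℕ → ℕ → Carrier
    term zero    B       = ∏ (λ i → y * Q ^ i) B
    term (suc a) zero    = ∏ (λ i → x * Q ^ i) (suc a)
    term (suc a) (suc B) = term a B

    term-0ʳ : ∀ a → term a 0 ≈ ∏ (λ i → x * Q ^ i) a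
    term-0ʳ zero    = refl
    term-0ʳ (suc a) = refl

    -- The terms of index k + 1 and k have ratio x Q^k. With k = a - B and a + b = A + B this
    -- becomes x Q^A after multiplication by Q^b, which also keeps the exponents natural.
    -- `term-down` treats the step from k to k - 1 in the same way.
    term-up : ∀ a b A B → a ℕ.+ b ≡ A ℕ.+ B → Q ^ b * term (suc a) B ≈ (x * Q ^ A) * term a B
    term-up a b A zero a+b≡A+0 = begin
      Q ^ b * ((x * Q ^ a) * ∏ (λ i → x * Q ^ i) a)
        ≈⟨ solve 4 (λ r s x p → r :* ((x :* s) :* p) := (x :* (s :* r)) :* p) refl _ _ _ _ ⟩
      (x * (Q ^ a * Q ^ b)) * ∏ (λ i → x * Q ^ i) a
        ≈⟨ *-cong (*-congˡ (trans (sym (^-homo-* Q a b))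
            (reflexive (≡.cong (Q ^_) (≡.trans a+b≡A+0 (ℕₚ.+-identityʳ A))))))
                  (sym (term-0ʳ a)) ⟩
      (x * Q ^ A) * term a 0 ∎
    term-up zero b A (suc B) b≡A+1+B = begin
      Q ^ b * term 0 B
        ≈⟨ *-congʳ (trans (reflexive (≡.cong (Q ^_) (≡.trans b≡A+1+B (ℕₚ.+-suc A B))))
            (*-congˡ (^-homo-* Q A B))) ⟩
      (Q * (Q ^ A * Q ^ B)) * term 0 B
        ≈⟨ solve 5 (λ x y r s t → (x :* y :* (r :* s)) :* t := (x :* r) :* ((y :* s) :* t))
            refl x y _ _ _ ⟩
      (x * Q ^ A) * term 0 (suc B) ∎
    term-up (suc a) b A (suc B) eq =
      term-up a b A B (ℕₚ.suc-injective (≡.trans eq (ℕₚ.+-suc A B)))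

    term-down : ∀ a B → Q ^ a * term a (suc B) ≈ (y * Q ^ B) * term a B
    term-down zero B = solve 2 (λ r t → :1 :* (r :* t) := r :* t) refl _ _
    term-down (suc a) zero = begin
      (Q * Q ^ a) * term a 0
        ≈⟨ *-congˡ (term-0ʳ a) ⟩
      (Q * Q ^ a) * ∏ (λ i → x * Q ^ i) a
        ≈⟨ solve 4 (λ x y r t → (x :* y :* r) :* t := (y :* :1) :* ((x :* r) :* t)) refl x y _ _ ⟩
      (y * 1#) * ((x * Q ^ a) * ∏ (λ i → x * Q ^ i) a) ∎
    term-down (suc a) (suc B) = begin
      (Q * Q ^ a) * term a (suc B)     ≈⟨ *-assoc _ _ _ ⟩
      Q * (Q ^ a * term a (suc B))     ≈⟨ *-congˡ (term-down a B) ⟩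
      Q * ((y * Q ^ B) * term a B)
        ≈⟨ solve 4 (λ q y r t → q :* ((y :* r) :* t) := (y :* (q :* r)) :* t) refl _ _ _ _ ⟩
      (y * (Q * Q ^ B)) * term a B     ∎

    -- The weight 1 gives the triple product itself, and weights linear in a give its derivative.
    weightedSum : (ℕ → Carrier) → ℕ → ℕ → Carrier
    weightedSum ν A B = antidiagonal (λ a b → ν a * (term a B * qbinomial a b)) (A ℕ.+ B)

    -- Pascal's rule splits a row into two copies of the previous one. In the copy with a shifted,
    -- `term-up` extracts x Q^A, which does not depend on a; for ν = 1 the two copies combine to the
    -- new factor 1 + x Q^A.
    weightedSum-suc-A : ∀ ν A B → weightedSum ν (suc A) B ≈
                        weightedSum ν A B + (x * Q ^ A) * weightedSum (ν ∘ suc) A B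
    weightedSum-suc-A ν A B = begin
      weightedSum ν (suc A) B
        ≈⟨ antidiagonal-pascal
             {λ a b → ν a * (term a B * qbinomial a b)}
             {λ a b → ν a * (term a B * qbinomial a b)}
             {λ a b → ν (suc a) * ((Q ^ b * term (suc a) B) * qbinomial a b)}
             {λ _ → 0#} (A ℕ.+ B)
             (λ b → sym (+-identityʳ _))
             (λ a → trans (*-congˡ (*-congˡ (sym (qbinomial-0ʳ a))))
               (solve 3 (λ n t g → n :* (t :* g) := n :* ((:1 :* t) :* g)) refl _ _ _))
             (λ a b → solve 5 (λ n t g r h → n :* (t :* (g :+ r :* h))
                 := n :* (t :* g) :+ n :* ((r :* t) :* h)) refl _ _ _ _ _) ⟩
      (weightedSum ν A B + antidiagonal
          (λ a b → ν (suc a) * ((Q ^ b * term (suc a) B) * qbinomial a b)) (A ℕ.+ B)) + 0#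
        ≈⟨ trans (+-identityʳ _) (+-congˡ (antidiagonal-cong (A ℕ.+ B) λ a b eq →
             trans (*-congˡ (*-congʳ (term-up a b A B eq)))
               (solve 4 (λ n u t g → n :* ((u :* t) :* g) := u :* (n :* (t :* g))) refl _ _ _ _))) ⟩
      weightedSum ν A B + antidiagonal
          (λ a b → (x * Q ^ A) * (ν (suc a) * (term a B * qbinomial a b))) (A ℕ.+ B)
        ≈⟨ +-congˡ (antidiagonal-* _ _ (A ℕ.+ B)) ⟩
      weightedSum ν A B + (x * Q ^ A) * weightedSum (ν ∘ suc) A B ∎

    weightedSum-suc-B : ∀ ν A B → weightedSum ν A (suc B) ≈
                        (y * Q ^ B) * weightedSum ν A B + weightedSum (ν ∘ suc) A B
    weightedSum-suc-B ν A B = begin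
      weightedSum ν A (suc B)
        ≈⟨ reflexive (≡.cong (antidiagonal _) (ℕₚ.+-suc A B)) ⟩
      antidiagonal (λ a b → ν a * (term a (suc B) * qbinomial a b)) (suc (A ℕ.+ B))
        ≈⟨ antidiagonal-pascal
             {λ a b → ν a * (term a (suc B) * qbinomial a b)}
             {λ a b → ν a * ((Q ^ a * term a (suc B)) * qbinomial a b)}
             {λ a b → ν (suc a) * (term a B * qbinomial a b)}
             {λ _ → 0#} (A ℕ.+ B)
             (λ b → trans (solve 2 (λ n t → n :* (t :* :1) := n :* ((:1 :* t) :* :1))
                 refl _ _) (sym (+-identityʳ _)))
             (λ a → *-congˡ (*-congˡ (sym (qbinomial-0ʳ a))))
             (λ a b → trans (*-congˡ (*-congˡ (qbinomial-pascal a b)))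
               (solve 5 (λ n t g r h → n :* (t :* (h :+ r :* g))
                   := n :* ((r :* t) :* g) :+ n :* (t :* h)) refl _ _ _ _ _)) ⟩
      (antidiagonal (λ a b → ν a * ((Q ^ a * term a (suc B)) * qbinomial a b)) (A ℕ.+ B)
          + weightedSum (ν ∘ suc) A B) + 0#
        ≈⟨ trans (+-identityʳ _) (+-congʳ (antidiagonal-cong (A ℕ.+ B) λ a b eq →
             trans (*-congˡ (*-congʳ (term-down a B)))
               (solve 4 (λ n u t g → n :* ((u :* t) :* g) := u :* (n :* (t :* g))) refl _ _ _ _))) ⟩
      antidiagonal (λ a b → (y * Q ^ B) * (ν a * (term a B * qbinomial a b))) (A ℕ.+ B)
          + weightedSum (ν ∘ suc) A B
        ≈⟨ +-congʳ (antidiagonal-* _ _ (A ℕ.+ B)) ⟩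
      (y * Q ^ B) * weightedSum ν A B + weightedSum (ν ∘ suc) A B ∎

    finite-triple-product : ∀ A B → weightedSum (λ _ → 1#) A B ≈
                            ∏ (λ i → 1# + x * Q ^ i) A * ∏ (λ i → 1# + y * Q ^ i) B
    finite-triple-product zero zero = solve 0 (:1 :* (:1 :* :1) := :1 :* :1) refl
    finite-triple-product (suc A) zero = begin
      weightedSum (λ _ → 1#) (suc A) 0
        ≈⟨ weightedSum-suc-A (λ _ → 1#) A 0 ⟩
      weightedSum (λ _ → 1#) A 0 + (x * Q ^ A) * weightedSum (λ _ → 1#) A 0
        ≈⟨ +-cong (finite-triple-product A 0) (*-congˡ (finite-triple-product A 0)) ⟩
      P * 1# + (x * Q ^ A) * (P * 1#)
        ≈⟨ solve 2 (λ p u → p :* :1 :+ u :* (p :* :1) := ((:1 :+ u) :* p) :* :1) refl _ _ ⟩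
      ((1# + x * Q ^ A) * P) * 1# ∎
      where P = ∏ (λ i → 1# + x * Q ^ i) A
    finite-triple-product A (suc B) = begin
      weightedSum (λ _ → 1#) A (suc B)
        ≈⟨ weightedSum-suc-B (λ _ → 1#) A B ⟩
      (y * Q ^ B) * weightedSum (λ _ → 1#) A B + weightedSum (λ _ → 1#) A B
        ≈⟨ +-cong (*-congˡ (finite-triple-product A B)) (finite-triple-product A B) ⟩
      (y * Q ^ B) * (P * P′) + P * P′
        ≈⟨ solve 3 (λ p p′ u → u :* (p :* p′) :+ p :* p′ := p :* ((:1 :+ u) :* p′)) refl _ _ _ ⟩
      P * ((1# + y * Q ^ B) * P′) ∎
      where
      P  = ∏ (λ i → 1# + x * Q ^ i) A
      P′ = ∏ (λ i → 1# + y * Q ^ i) B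

    weightedSum-cong : ∀ {ν ν′} A B → (∀ a → ν a ≈ ν′ a) → weightedSum ν A B ≈ weightedSum ν′ A B
    weightedSum-cong A B ν≈ν′ = antidiagonal-cong (A ℕ.+ B) λ a b _ → *-congʳ (ν≈ν′ a)

    weightedSum-shift : ∀ r ν A B → weightedSum (λ a → ν a + r) A B ≈
                        weightedSum ν A B + r * weightedSum (λ _ → 1#) A B
    weightedSum-shift r ν A B = begin
      weightedSum (λ a → ν a + r) A B
        ≈⟨ antidiagonal-cong (A ℕ.+ B) (λ a b _ →
             solve 3 (λ n r t → (n :+ r) :* t := n :* t :+ r :* (:1 :* t)) refl _ _ _) ⟩
      antidiagonal (λ a b → ν a * (term a B * qbinomial a b) + r *
          (1# * (term a B * qbinomial a b))) (A ℕ.+ B)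
        ≈⟨ antidiagonal-+ _ _ (A ℕ.+ B) ⟩
      weightedSum ν A B + antidiagonal (λ a b → r * (1# * (term a B * qbinomial a b))) (A ℕ.+ B)
        ≈⟨ +-congˡ (antidiagonal-* r _ (A ℕ.+ B)) ⟩
      weightedSum ν A B + r * weightedSum (λ _ → 1#) A B ∎

    -- At y = −1 the triple product has a simple zero, and the linear weights
    -- ν B a = 2 (a − B) + const pick out its derivative there.
    finite-triple-product′ : y ≈ - 1# → (ν : ℕ → ℕ → Carrier) →
      (∀ B a → ν (suc B) (suc a) ≈ ν B a) → (∀ B a → ν (suc B) a ≈ ν B a + ι (ℤ.- + 2)) →
      ∀ A B → weightedSum (ν (suc B)) A (suc B) ≈
              ι (+ 2) * (∏ (λ i → 1# + x * Q ^ i) A * ∏ (λ i → 1# + y * Q ^ suc i) B)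
    finite-triple-product′ y≈-1 ν diagonal step A = go
      where
      P = ∏ (λ i → 1# + x * Q ^ i) A
      D : ℕ → Carrier
      D B = weightedSum (ν B) A B
      W : ℕ → Carrier
      W = weightedSum (λ _ → 1#) A
      D-suc : ∀ B → D (suc B) ≈ (y * Q ^ B) * (D B + ι (ℤ.- + 2) * W B) + D B
      D-suc B = begin
        D (suc B)
          ≈⟨ weightedSum-suc-B (ν (suc B)) A B ⟩
        (y * Q ^ B) * weightedSum (ν (suc B)) A B + weightedSum (ν (suc B) ∘ suc) A B
          ≈⟨ +-cong (*-congˡ (trans (weightedSum-cong A B (step B))
              (weightedSum-shift _ (ν B) A B)))
                    (weightedSum-cong A B (diagonal B)) ⟩
        (y * Q ^ B) * (D B + ι (ℤ.- + 2) * W B) + D B ∎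
      -- From B = 1 on the product contains the factor 1 + y = 0. So the shift of the weights by -2
      -- contributes only when B goes from 0 to 1, and there it produces the factor 2.
      W-suc : ∀ B → W (suc B) ≈ 0#
      W-suc B = trans (finite-triple-product A (suc B)) (trans (*-congˡ (vanish B)) (zeroʳ P))
        where
        vanish : ∀ B → ∏ (λ i → 1# + y * Q ^ i) (suc B) ≈ 0#
        vanish zero    = trans (*-congʳ
            (trans (+-congˡ (trans (*-identityʳ y) y≈-1)) (-‿inverseʳ 1#))) (zeroˡ _)
        vanish (suc B) = trans (*-congˡ (vanish B)) (zeroʳ _)
      go : ∀ B → D (suc B) ≈ ι (+ 2) * (P * ∏ (λ i → 1# + y * Q ^ suc i) B)
      go zero = begin
        D 1                                               ≈⟨ D-suc 0 ⟩
        (y * 1#) * (D 0 + ι (ℤ.- + 2) * W 0) + D 0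
          ≈⟨ +-congʳ (*-cong (*-congʳ y≈-1) (+-congˡ (*-congˡ (finite-triple-product A 0)))) ⟩
        (- 1# * 1#) * (D 0 + ι (ℤ.- + 2) * (P * 1#)) + D 0
          ≈⟨ solve 2 (λ d p → (:- :1 :* :1) :* (d :+ con (ℤ.- + 2) :* (p :* :1)) :+ d
               := con (+ 2) :* (p :* :1)) refl _ _ ⟩
        ι (+ 2) * (P * 1#)                                 ∎
      go (suc B) = begin
        D (suc (suc B))
          ≈⟨ D-suc (suc B) ⟩
        (y * Q ^ suc B) * (D (suc B) + ι (ℤ.- + 2) * W (suc B)) + D (suc B)
          ≈⟨ +-congʳ (*-congˡ (trans (+-congˡ (trans (*-congˡ (W-suc B)) (zeroʳ _)))
              (+-identityʳ _))) ⟩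
        (y * Q ^ suc B) * D (suc B) + D (suc B)
          ≈⟨ solve 2 (λ u d → u :* d :+ d := (:1 :+ u) :* d) refl _ _ ⟩
        (1# + y * Q ^ suc B) * D (suc B)
          ≈⟨ *-congˡ (go B) ⟩
        (1# + y * Q ^ suc B) * (ι (+ 2) * (P * P′))
          ≈⟨ solve 4 (λ u c p p′ → u :* (c :* (p :* p′)) := c :* (p :* (u :* p′))) refl _ _ _ _ ⟩
        ι (+ 2) * (P * ((1# + y * Q ^ suc B) * P′)) ∎
        where P′ = ∏ (λ i → 1# + y * Q ^ suc i) B

  -- Finite sums over lists and sign-reversing involutions

  module _ {a} {A : Set a} where

    ∑ : (A → Carrier) → List A → Carrier
    ∑ f []       = 0#
    ∑ f (x ∷ xs) = f x + ∑ f xs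

    ∑-cong : ∀ {f g} L → (∀ x → f x ≈ g x) → ∑ f L ≈ ∑ g L
    ∑-cong []      f≈g = refl
    ∑-cong (x ∷ L) f≈g = +-cong (f≈g x) (∑-cong L f≈g)

    ∑-+ : ∀ f g L → ∑ (λ x → f x + g x) L ≈ ∑ f L + ∑ g L
    ∑-+ f g []      = sym (+-identityʳ 0#)
    ∑-+ f g (x ∷ L) = trans (+-congˡ (∑-+ f g L))
      (solve 4 (λ a b c d → (a :+ b) :+ (c :+ d) := (a :+ c) :+ (b :+ d)) refl _ _ _ _)

    ∑-*ˡ : ∀ r f L → ∑ (λ x → r * f x) L ≈ r * ∑ f L
    ∑-*ˡ r f []      = sym (zeroʳ r)
    ∑-*ˡ r f (x ∷ L) = trans (+-congˡ (∑-*ˡ r f L)) (sym (distribˡ r _ _))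

    ∑-++ : ∀ f L M → ∑ f (L ++ M) ≈ ∑ f L + ∑ f M
    ∑-++ f []      M = sym (+-identityˡ _)
    ∑-++ f (x ∷ L) M = trans (+-congˡ (∑-++ f L M)) (sym (+-assoc _ _ _))

    ∑-zero : ∀ f L → (∀ x → x ∈ L → f x ≈ 0#) → ∑ f L ≈ 0#
    ∑-zero f []      f≈0 = refl
    ∑-zero f (x ∷ L) f≈0 =
      trans (+-cong (f≈0 x (here ≡.refl)) (∑-zero f L λ y → f≈0 y ∘ there)) (+-identityʳ 0#)

    ∑-↭ : ∀ f {L M} → L ↭ M → ∑ f L ≈ ∑ f M
    ∑-↭ f ↭-refl          = refl
    ∑-↭ f (prep x L↭M)    = +-congˡ (∑-↭ f L↭M)
    ∑-↭ f (swap x y L↭M)  = trans (+-congˡ (+-congˡ (∑-↭ f L↭M)))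
      (solve 3 (λ a b c → a :+ (b :+ c) := b :+ (a :+ c)) refl _ _ _)
    ∑-↭ f (↭-tr L↭K K↭M)  = trans (∑-↭ f L↭K) (∑-↭ f K↭M)

    -- The lists may differ where f vanishes. This freedom is needed because `rotate` does not map
    -- the square of indices of absolute value at most N + 1 to itself; for instance (K , K) goes to
    -- (0 , 2 K).
    ∑-support : ∀ f {L M} → Unique L → Unique M →
                (∀ x → x ∈ L → f x ≈ 0# ⊎ x ∈ M) → (∀ x → x ∈ M → f x ≈ 0# ⊎ x ∈ L) →
                ∑ f L ≈ ∑ f M
    ∑-support f {[]} {M} _ _ _ M⊆L = sym (∑-zero f M (λ x → vanish x ∘ M⊆L x))
      where
      vanish : ∀ x → f x ≈ 0# ⊎ x ∈ [] → f x ≈ 0#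
      vanish x (inj₁ fx≈0) = fx≈0
    ∑-support f {x ∷ L} {M} L!@(_ ∷ L!′) M! L⊆M M⊆L with L⊆M x (here ≡.refl)
    ... | inj₁ fx≈0 = trans (+-cong fx≈0
        (∑-support f L!′ M! (λ y → L⊆M y ∘ there) (λ y → tail ∘ M⊆L y))) (+-identityˡ _)
      where
      tail : ∀ {y} → f y ≈ 0# ⊎ y ∈ x ∷ L → f y ≈ 0# ⊎ y ∈ L
      tail (inj₁ fy≈0)           = inj₁ fy≈0
      tail (inj₂ (here ≡.refl))  = inj₁ fx≈0
      tail (inj₂ (there y∈L))    = inj₂ y∈L
    ... | inj₂ x∈M with ys , zs , ≡.refl ← ∈-∃++ x∈M = begin
      f x + ∑ f L            ≈⟨ +-congˡ (∑-support f L!′ M!′ L⊆M′ M′⊆L) ⟩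
      f x + ∑ f (ys ++ zs)   ≈⟨ ∑-↭ f (↭-sym M↭) ⟩
      ∑ f M                  ∎
      where
      M↭ : M ↭ x ∷ ys ++ zs
      M↭ = shift x ys zs
      xM! : Unique (x ∷ ys ++ zs)
      xM! = ↭ₛ.Unique-resp-↭ (≡.setoid A) (↭⇒↭ₛ M↭) M!
      M!′ : Unique (ys ++ zs)
      M!′ with _ ∷ u ← xM! = u
      L⊆M′ : ∀ y → y ∈ L → f y ≈ 0# ⊎ y ∈ ys ++ zs
      L⊆M′ y y∈L with L⊆M y (there y∈L)
      ... | inj₁ fy≈0 = inj₁ fy≈0
      ... | inj₂ y∈M with ∈-resp-↭ M↭ y∈M
      ...   | here ≡.refl = contradiction y∈L (Unique.Unique[x∷xs]⇒x∉xs L!)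
      ...   | there y∈M′  = inj₂ y∈M′
      M′⊆L : ∀ y → y ∈ ys ++ zs → f y ≈ 0# ⊎ y ∈ L
      M′⊆L y y∈M′ with M⊆L y (∈-resp-↭ (↭-sym M↭) (there y∈M′))
      ... | inj₁ fy≈0         = inj₁ fy≈0
      ... | inj₂ (here ≡.refl) = contradiction y∈M′ (Unique.Unique[x∷xs]⇒x∉xs xM!)
      ... | inj₂ (there y∈L)  = inj₂ y∈L

  ∑-map : ∀ {a b} {A : Set a} {B : Set b} f (g : A → B) L → ∑ f (map g L) ≈ ∑ (f ∘ g) L
  ∑-map f g []      = refl
  ∑-map f g (x ∷ L) = +-congˡ (∑-map f g L)

  ∑-product : ∀ {a b} {A : Set a} {B : Set b} (f : A → Carrier) (g : B → Carrier) L M →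
              ∑ f L * ∑ g M ≈ ∑ (λ (x , y) → f x * g y) (cartesianProduct L M)
  ∑-product f g []      M = zeroˡ _
  ∑-product f g (x ∷ L) M = begin
    (f x + ∑ f L) * ∑ g M             ≈⟨ distribʳ _ _ _ ⟩
    f x * ∑ g M + ∑ f L * ∑ g M
      ≈⟨ +-cong (trans (sym (∑-*ˡ (f x) g M)) (sym (∑-map _ (x ,_) M))) (∑-product f g L M) ⟩
    ∑ h (map (x ,_) M) + ∑ h (cartesianProduct L M)   ≈⟨ ∑-++ h (map (x ,_) M) _ ⟨
    ∑ h (map (x ,_) M ++ cartesianProduct L M)        ∎
    where h = λ (x , y) → f x * g y

  -- Reindexing by ρ gives ∑ f = - ∑ f. Fixed points are not treated separately, whence the
  -- hypothesis that 2 can be cancelled.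
  ∑-involution : ∀ {a} {A : Set a} → (∀ r → ι (+ 2) * r ≈ 0# → r ≈ 0#) →
    ∀ f (ρ : A → A) → (∀ x → ρ (ρ x) ≡ x) → (∀ x → f (ρ x) ≈ - f x) →
    ∀ {L} → Unique L → (∀ x → f x ≈ 0# ⊎ x ∈ L) → ∑ f L ≈ 0#
  ∑-involution 2-cancel f ρ ρ² f∘ρ {L} L! support = 2-cancel _ (begin
    ι (+ 2) * ∑ f L             ≈⟨ solve 1 (λ s → con (+ 2) :* s := s :+ s) refl _ ⟩
    ∑ f L + ∑ f L               ≈⟨ +-congʳ (∑-support f L! (Unique.map⁺ ρ-injective L!) to from) ⟩
    ∑ f (map ρ L) + ∑ f L       ≈⟨ +-congʳ (trans (∑-map f ρ L) (∑-cong L f∘ρ)) ⟩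
    ∑ (λ x → - f x) L + ∑ f L   ≈⟨ ∑-+ (λ x → - f x) f L ⟨
    ∑ (λ x → - f x + f x) L     ≈⟨ ∑-zero _ L (λ x _ → -‿inverseˡ (f x)) ⟩
    0#                          ∎)
    where
    ρ-injective : ∀ {x y} → ρ x ≡ ρ y → x ≡ y
    ρ-injective {x} {y} eq = ≡.trans (≡.sym (ρ² x)) (≡.trans (≡.cong ρ eq) (ρ² y))
    from : ∀ x → x ∈ map ρ L → f x ≈ 0# ⊎ x ∈ L
    from x _ = support x
    to : ∀ x → x ∈ L → f x ≈ 0# ⊎ x ∈ map ρ L
    to x _ with support (ρ x)
    ... | inj₁ fρx≈0 = inj₁ (begin
      f x          ≈⟨ solve 1 (λ s → s := :- (:- s)) refl _ ⟩
      - (- f x)    ≈⟨ -‿cong (trans (sym (f∘ρ x)) fρx≈0) ⟩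
      - 0#         ≈⟨ -0#≈0# ⟩
      0#           ∎)
    ... | inj₂ ρx∈L = inj₂ (≡.subst (_∈ map ρ L) (ρ² x) (∈-map⁺ ρ ρx∈L))

  antidiagonal-last : ∀ f m → antidiagonal f (suc m) ≈
                      antidiagonal (λ a b → f a (suc b)) m + f (suc m) 0
  antidiagonal-last f zero    = refl
  antidiagonal-last f (suc m) = trans (+-congˡ (antidiagonal-last (f ∘ suc) m))
      (sym (+-assoc _ _ _))

  antidiagonal-range : ∀ (h : ℤ → Carrier) n →
                       antidiagonal (λ a b → h (a ⊖ n)) (n ℕ.+ n) ≈ ∑ h (range n)
  antidiagonal-range h zero    = sym (+-identityʳ _)
  antidiagonal-range h (suc n) = begin
    antidiagonal (λ a b → h (a ⊖ suc n)) (suc (n ℕ.+ suc n))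
      ≈⟨ reflexive (≡.cong (antidiagonal (λ a b → h (a ⊖ suc n)) ∘ suc) (ℕₚ.+-suc n n)) ⟩
    h -[1+ n ] + antidiagonal (λ a b → h (suc a ⊖ suc n)) (suc (n ℕ.+ n))
      ≈⟨ +-congˡ (antidiagonal-last (λ a b → h (suc a ⊖ suc n)) (n ℕ.+ n)) ⟩
    h -[1+ n ] + (antidiagonal (λ a b → h (suc a ⊖ suc n)) (n ℕ.+ n) + h
        (suc (suc (n ℕ.+ n)) ⊖ suc n))
      ≈⟨ +-congˡ (+-cong
           (trans (antidiagonal-cong (n ℕ.+ n) λ a b _ → reflexive
               (≡.cong h (ℤₚ.[1+m]⊖[1+n]≡m⊖n a n)))
                  (antidiagonal-range h n))
           (reflexive (≡.cong h (last n)))) ⟩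
    h -[1+ n ] + (∑ h (range n) + h (+ suc n))
      ≈⟨ solve 3 (λ a b c → a :+ (b :+ c) := c :+ (a :+ b)) refl _ _ _ ⟩
    ∑ h (range (suc n)) ∎
    where
    last : ∀ n → suc (suc (n ℕ.+ n)) ⊖ suc n ≡ + suc n
    last n = ≡.trans (ℤₚ.⊖-≥ (ℕₚ.m≤n⇒m≤1+n (ℕ.s≤s (ℕₚ.m≤m+n n n))))
      (≡.cong +_ (≡.trans (≡.cong (ℕ._∸ n) (≡.sym (ℕₚ.+-suc n n))) (ℕₚ.m+n∸m≡n n (suc n))))

  ∑-range-extend : ∀ h {n m} → n ℕ.≤ m → (∀ k → n ℕ.< ∣ k ∣ → h k ≈ 0#) →
                   ∑ h (range m) ≈ ∑ h (range n)
  ∑-range-extend h {n} n≤m h≈0 with k , ≡.refl ← ℕₚ.m≤n⇒∃[o]m+o≡n n≤m = go k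
    where
    go : ∀ k → ∑ h (range (n ℕ.+ k)) ≈ ∑ h (range n)
    go zero    = reflexive (≡.cong (∑ h ∘ range) (ℕₚ.+-identityʳ n))
    go (suc k) = begin
      ∑ h (range (n ℕ.+ suc k))    ≈⟨ reflexive (≡.cong (∑ h ∘ range) (ℕₚ.+-suc n k)) ⟩
      h (+ suc (n ℕ.+ k)) + (h -[1+ n ℕ.+ k ] + ∑ h (range (n ℕ.+ k)))
        ≈⟨ +-cong (h≈0 _ n<) (+-cong (h≈0 _ n<) (go k)) ⟩
      0# + (0# + ∑ h (range n))    ≈⟨ trans (+-identityˡ _) (+-identityˡ _) ⟩
      ∑ h (range n)                ∎
      where n< = ℕ.s≤s (ℕₚ.m≤m+n n k)

  -- Units and fifth powers

  Unit : Carrier → Set _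
  Unit u = ∃ λ v → u * v ≈ 1#

  unit-cancelʳ : ∀ {u} → Unit u → ∀ {x y} → x * u ≈ y * u → x ≈ y
  unit-cancelʳ {u} (v , uv≈1) {x} {y} eq = begin
    x              ≈⟨ *-identityʳ x ⟨
    x * 1#         ≈⟨ *-congˡ uv≈1 ⟨
    x * (u * v)    ≈⟨ *-assoc x u v ⟨
    (x * u) * v    ≈⟨ *-congʳ eq ⟩
    (y * u) * v    ≈⟨ *-assoc y u v ⟩
    y * (u * v)    ≈⟨ *-congˡ uv≈1 ⟩
    y * 1#         ≈⟨ *-identityʳ y ⟩
    y              ∎

  unit-* : ∀ {u v} → Unit u → Unit v → Unit (u * v)
  unit-* (u′ , uu′≈1) (v′ , vv′≈1) = u′ * v′ ,
    trans (solve 4 (λ u v u′ v′ → (u :* v) :* (u′ :* v′) := (u :* u′) :* (v :* v′)) refl _ _ _ _)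
      (trans (*-cong uu′≈1 vv′≈1) (*-identityʳ 1#))

  -- For z^m = 0 this inverts 1 - z.
  geometric : ∀ z m → ∃ λ v → (1# - z) * v ≈ 1# - z ^ m
  geometric z zero    = 0# , trans (zeroʳ _) (sym (-‿inverseʳ 1#))
  geometric z (suc m) with v , eq ← geometric z m = 1# + z * v , (begin
    (1# - z) * (1# + z * v)
      ≈⟨ solve 2 (λ z v → (:1 :- z) :* (:1 :+ z :* v) := (:1 :- z) :+ z :* ((:1 :- z) :* v))
          refl _ _ ⟩
    (1# - z) + z * ((1# - z) * v)    ≈⟨ +-congˡ (*-congˡ eq) ⟩
    (1# - z) + z * (1# - z ^ m)
      ≈⟨ solve 2 (λ z r → (:1 :- z) :+ z :* (:1 :- r) := :1 :- z :* r) refl _ _ ⟩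
    1# - z * z ^ m                   ∎)

  ∏-first : ∀ f n → ∏ f (suc n) ≈ f 0 * ∏ (f ∘ suc) n
  ∏-first f zero    = refl
  ∏-first f (suc n) = trans (*-congˡ (∏-first f n))
    (solve 3 (λ a b c → a :* (b :* c) := b :* (a :* c)) refl _ _ _)

  -- Every binomial coefficient (5 choose i) with 0 < i < 5 is divisible by 5.
  frobenius : ∀ {a} {A : Set a} (f : A → Carrier) L →
              ∃ λ U → ∑ f L ^ 5 ≈ ∑ (λ x → f x ^ 5) L + ι (+ 5) * U
  frobenius f []      = 0# , trans (zeroˡ _) (sym (trans (+-identityˡ _) (zeroʳ _)))
  frobenius f (x ∷ L) with U , eq ← frobenius f L = U + V , (begin
    (y + z) ^ 5
      ≈⟨ solve 2 (λ y z → (y :+ z) :^ 5 := (y :^ 5 :+ z :^ 5) :+ con (+ 5) :*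
           (y :^ 4 :* z :+ con (+ 2) :* y :^ 3 :* z :^ 2 :+ con (+ 2) :* y :^ 2 :* z :^ 3 :+ y :* z
               :^ 4)) refl y z ⟩
    (y ^ 5 + z ^ 5) + ι (+ 5) * V
      ≈⟨ +-congʳ (+-congˡ eq) ⟩
    (y ^ 5 + (w + ι (+ 5) * U)) + ι (+ 5) * V
      ≈⟨ solve 5 (λ y w c u v → (y :+ (w :+ c :* u)) :+ c :* v := (y :+ w) :+ c :* (u :+ v))
          refl _ _ _ _ _ ⟩
    (y ^ 5 + w) + ι (+ 5) * (U + V) ∎)
    where
    y = f x
    z = ∑ f L
    w = ∑ (λ x → f x ^ 5) L
    V = y ^ 4 * z + ι (+ 2) * y ^ 3 * z ^ 2 + ι (+ 2) * y ^ 2 * z ^ 3 + y * z ^ 4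

  ι-^ : ∀ i n → ι (i ℤ.^ n) ≈ ι i ^ n
  ι-^ i zero    = 1-homo
  ι-^ i (suc n) = trans (*-homo i (i ℤ.^ n)) (*-congˡ (ι-^ i n))

  ι-ε^5 : ∀ k → ι (ε k) ^ 5 ≈ ι (ε k)
  ι-ε^5 k = trans (sym (ι-^ (ε k) 5)) (ι-cong (ε^5 (ε-parity k)))
    where
    ε^5 : (∃ λ h → k ≡ + 2 ℤ.* h × ε k ≡ 1ℤ) ⊎ (∃ λ h → k ≡ 1ℤ ℤ.+ + 2 ℤ.* h × ε k ≡ -1ℤ)
        → ε k ℤ.^ 5 ≡ ε k
    ε^5 (inj₁ (_ , _ , eq)) rewrite eq = ≡.refl
    ε^5 (inj₂ (_ , _ , eq)) rewrite eq = ≡.refl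

  -- Theta series and infinite products for nilpotent q

  module Nilpotent (q : Carrier) (N : ℕ) (q^1+N≈0 : q ^ suc N ≈ 0#) where

    q^-vanish : ∀ {n} → N ℕ.< n → q ^ n ≈ 0#
    q^-vanish {n} N<n with k , ≡.refl ← ℕₚ.m≤n⇒∃[o]m+o≡n N<n =
      trans (^-homo-* q (suc N) k) (trans (*-congʳ q^1+N≈0) (zeroˡ _))

    q^exponent-vanish : ∀ c c′ .{{_ : ℕ.NonZero (c ℕ.+ c′)}} k → suc N ℕ.< ∣ k ∣ →
                        q ^ exponent c c′ k ≈ 0#
    q^exponent-vanish c c′ k 1+N<∣k∣ =
      q^-vanish (ℕ.s≤s⁻¹ (ℕₚ.≤-trans 1+N<∣k∣ (∣k∣≤1+exponent c c′ k)))

    -- The terms left out have |k| > N + 1 and are multiples of q^(N+1).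
    θ : (ℤ → ℤ) → ℕ → ℕ → Carrier
    θ w c c′ = ∑ (λ k → ι (w k) * q ^ exponent c c′ k) (range (suc N))

    product : ℕ → ℕ → Carrier
    product d = ∏ (λ i → 1# - q ^ (d ℕ.* suc i))

    product-stable : ∀ d .{{_ : ℕ.NonZero d}} {n m} → N ℕ.≤ n → n ℕ.≤ m → product d m ≈ product d n
    product-stable d {n} N≤n n≤m with k , ≡.refl ← ℕₚ.m≤n⇒∃[o]m+o≡n n≤m = go k
      where
      go : ∀ k → product d (n ℕ.+ k) ≈ product d n
      go zero    = reflexive (≡.cong (product d) (ℕₚ.+-identityʳ n))
      go (suc k) = begin
        product d (n ℕ.+ suc k)      ≈⟨ reflexive (≡.cong (product d) (ℕₚ.+-suc n k)) ⟩
        (1# - q ^ (d ℕ.* suc (n ℕ.+ k))) * product d (n ℕ.+ k)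
          ≈⟨ *-cong (+-congˡ (-‿cong (q^-vanish {d ℕ.* suc (n ℕ.+ k)}
              (ℕₚ.<-≤-trans (ℕ.s≤s (ℕₚ.≤-trans N≤n (ℕₚ.m≤m+n n k))) (ℕₚ.m≤n*m _ d))))) (go k) ⟩
        (1# - 0#) * product d n      ≈⟨ *-congʳ (trans (+-congˡ -0#≈0#) (+-identityʳ 1#)) ⟩
        1# * product d n             ≈⟨ *-identityˡ _ ⟩
        product d n                  ∎

    1-q^-unit : ∀ n → Unit (1# - q ^ suc n)
    1-q^-unit n with v , eq ← geometric (q ^ suc n) (suc N) = v , (begin
      (1# - q ^ suc n) * v             ≈⟨ eq ⟩
      1# - (q ^ suc n) ^ suc N
        ≈⟨ +-congˡ (-‿cong (trans (^-assocʳ q (suc n) (suc N))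
            (q^-vanish {suc n ℕ.* suc N} (ℕₚ.m≤n*m (suc N) (suc n))))) ⟩
      1# - 0#                          ≈⟨ trans (+-congˡ -0#≈0#) (+-identityʳ 1#) ⟩
      1#                               ∎)

    product-unit : ∀ d .{{_ : ℕ.NonZero d}} n → Unit (product d n)
    product-unit d zero    = 1# , *-identityʳ 1#
    product-unit d@(suc d-1) (suc n) = unit-* (1-q^-unit (n ℕ.+ d-1 ℕ.* suc n)) (product-unit d n)

    -- The infinite product (q^d; q^d)_∞; the factors beyond the N-th are 1.
    E : ℕ → Carrier
    E d = product d N

    product≈E : ∀ d .{{_ : ℕ.NonZero d}} {n} → N ℕ.≤ n → product d n ≈ E d
    product≈E d = product-stable d ℕₚ.≤-refl

    module Signed (s : ℤ) (s²≡1 : s ℤ.* s ≡ 1ℤ) (c c′ : ℕ) .{{_ : ℕ.NonZero (c ℕ.+ c′)}} where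

      private
        d = c ℕ.+ c′
        x = ι s * q ^ c
        y = ι s * q ^ c′

      open TripleProduct x y public

      Q^-exponent : ∀ n → Q ^ n ≈ q ^ (d ℕ.* n)
      Q^-exponent n = trans (^-congˡ n Q≈q^d) (^-assocʳ q d n)
        where
        Q≈q^d : Q ≈ q ^ d
        Q≈q^d = begin
          (ι s * q ^ c) * (ι s * q ^ c′)
            ≈⟨ solve 3 (λ s r r′ → (s :* r) :* (s :* r′) := (s :* s) :* (r :* r′)) refl _ _ _ ⟩
          (ι s * ι s) * (q ^ c * q ^ c′)
            ≈⟨ *-cong (trans (sym (*-homo s s)) (trans (ι-cong s²≡1) 1-homo))
                (sym (^-homo-* q c c′)) ⟩
          1# * q ^ d  ≈⟨ *-identityˡ _ ⟩
          q ^ d       ∎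

      factor : ∀ b i → (ι s * q ^ b) * Q ^ i ≈ ι s * q ^ (b ℕ.+ d ℕ.* i)
      factor b i = trans (*-assoc _ _ _)
          (*-congˡ (trans (*-congˡ (Q^-exponent i)) (sym (^-homo-* q b (d ℕ.* i)))))

      ∏-factor : ∀ b n → ∏ (λ i → (ι s * q ^ b) * Q ^ i) n ≈ ι (s ℤ.^ n) * q ^ quadratic b d n
      ∏-factor b zero    = sym (trans (*-identityʳ _) 1-homo)
      ∏-factor b (suc n) = begin
        ((ι s * q ^ b) * Q ^ n) * ∏ (λ i → (ι s * q ^ b) * Q ^ i) n
          ≈⟨ *-cong (factor b n) (∏-factor b n) ⟩
        (ι s * q ^ (b ℕ.+ d ℕ.* n)) * (ι (s ℤ.^ n) * q ^ quadratic b d n)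
          ≈⟨ solve 4 (λ s r t u → (s :* r) :* (t :* u) := (s :* t) :* (r :* u)) refl _ _ _ _ ⟩
        (ι s * ι (s ℤ.^ n)) * (q ^ (b ℕ.+ d ℕ.* n) * q ^ quadratic b d n)
          ≈⟨ *-cong (*-homo s (s ℤ.^ n)) (^-homo-* q (b ℕ.+ d ℕ.* n) (quadratic b d n)) ⟨
        ι (s ℤ.^ suc n) * q ^ quadratic b d (suc n) ∎

      term≈ : ∀ a B → term a B ≈ ι (s ℤ.^ ∣ a ⊖ B ∣) * q ^ exponent c c′ (a ⊖ B)
      term≈ zero    zero    = ∏-factor c′ 0
      term≈ zero    (suc B) = ∏-factor c′ (suc B)
      term≈ (suc a) zero    = ∏-factor c (suc a)
      term≈ (suc a) (suc B) = trans (term≈ a B)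
        (reflexive (≡.cong (λ k → ι (s ℤ.^ ∣ k ∣) * q ^ exponent c c′ k)
            (≡.sym (ℤₚ.[1+m]⊖[1+n]≡m⊖n a B))))

      pochhammer≈product : ∀ n → pochhammer n ≈ product d n
      pochhammer≈product n = ∏-cong n λ i → +-congˡ (-‿cong (Q^-exponent (suc i)))

      -- In the product formula for the binomial all three Pochhammer symbols have already become
      -- `E d`, and one of them is cancelled as a unit.
      qbinomial-limit : ∀ {a b} → N ℕ.≤ a → N ℕ.≤ b → qbinomial a b * E d ≈ 1#
      qbinomial-limit {a} {b} N≤a N≤b = unit-cancelʳ (product-unit d N) (begin
        (qbinomial a b * E d) * E d
          ≈⟨ *-assoc _ _ _ ⟩
        qbinomial a b * (E d * E d)
          ≈⟨ *-congˡ (*-cong (product≈E d N≤a) (product≈E d N≤b)) ⟨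
        qbinomial a b * (product d a * product d b)
          ≈⟨ *-congˡ (*-cong (pochhammer≈product a) (pochhammer≈product b)) ⟨
        qbinomial a b * (pochhammer a * pochhammer b)
          ≈⟨ qbinomial-pochhammer a b ⟩
        pochhammer (a ℕ.+ b)
          ≈⟨ pochhammer≈product (a ℕ.+ b) ⟩
        product d (a ℕ.+ b)
          ≈⟨ product≈E d (ℕₚ.≤-trans N≤a (ℕₚ.m≤m+n a b)) ⟩
        E d
          ≈⟨ *-identityˡ _ ⟨
        1# * E d ∎)

      -- Letting A and B tend to infinity in the finite triple product.
      θ≈weightedSum : ∀ (v : ℤ → ℤ) n → suc N ℕ.+ suc N ℕ.≤ n →
        θ (λ k → v k ℤ.* s ℤ.^ ∣ k ∣) c c′ ≈ weightedSum (λ a → ι (v (a ⊖ n))) n n * E d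
      θ≈weightedSum v n large = sym (begin
        weightedSum (λ a → ι (v (a ⊖ n))) n n * E d
          ≈⟨ trans (*-comm _ _) (sym (antidiagonal-* (E d) _ (n ℕ.+ n))) ⟩
        antidiagonal (λ a b → E d * (ι (v (a ⊖ n)) * (term a n * qbinomial a b))) (n ℕ.+ n)
          ≈⟨ antidiagonal-cong (n ℕ.+ n) summand≈ ⟩
        antidiagonal (λ a b → h (a ⊖ n)) (n ℕ.+ n)
          ≈⟨ antidiagonal-range h n ⟩
        ∑ h (range n)
          ≈⟨ ∑-range-extend h (ℕₚ.≤-trans (ℕₚ.m≤m+n (suc N) (suc N)) large)
               (λ k 1+N<∣k∣ → trans (*-congˡ (q^exponent-vanish c c′ k 1+N<∣k∣)) (zeroʳ _)) ⟩
        ∑ h (range (suc N)) ∎)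
        where
        h : ℤ → Carrier
        h k = ι (v k ℤ.* s ℤ.^ ∣ k ∣) * q ^ exponent c c′ k
        h⊖≈ : ∀ a → h (a ⊖ n) ≈ ι (v (a ⊖ n)) * term a n
        h⊖≈ a = trans (*-congʳ (*-homo _ _)) (trans (*-assoc _ _ _) (*-congˡ (sym (term≈ a n))))
        summand≈ : ∀ a b → a ℕ.+ b ≡ n ℕ.+ n →
                   E d * (ι (v (a ⊖ n)) * (term a n * qbinomial a b)) ≈ h (a ⊖ n)
        summand≈ a b a+b≡2n with ∣ a ⊖ n ∣ ℕₚ.≤? suc N
        ... | yes small with N≤a , N≤b ← ⊖-central N large a+b≡2n small = begin
          E d * (ι (v (a ⊖ n)) * (term a n * qbinomial a b))
            ≈⟨ solve 4 (λ e v t g → e :* (v :* (t :* g)) := (v :* t) :* (g :* e)) refl _ _ _ _ ⟩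
          (ι (v (a ⊖ n)) * term a n) * (qbinomial a b * E d)
            ≈⟨ *-cong (sym (h⊖≈ a)) (qbinomial-limit N≤a N≤b) ⟩
          h (a ⊖ n) * 1#  ≈⟨ *-identityʳ _ ⟩
          h (a ⊖ n)       ∎
        ... | no large′ = begin
          E d * (ι (v (a ⊖ n)) * (term a n * qbinomial a b))
            ≈⟨ solve 4 (λ e v t g → e :* (v :* (t :* g)) := (v :* t) :* (g :* e)) refl _ _ _ _ ⟩
          (ι (v (a ⊖ n)) * term a n) * (qbinomial a b * E d)
            ≈⟨ *-congʳ (trans (sym (h⊖≈ a)) h≈0) ⟩
          0# * (qbinomial a b * E d)  ≈⟨ zeroˡ _ ⟩
          0#                          ≈⟨ h≈0 ⟨
          h (a ⊖ n)                   ∎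
          where
          h≈0 : h (a ⊖ n) ≈ 0#
          h≈0 = trans (*-congˡ (q^exponent-vanish c c′ (a ⊖ n) (ℕₚ.≰⇒> large′))) (zeroʳ _)

    -- A row long enough for `θ≈weightedSum`, which asks for 2 (N + 1). The additional successor
    -- leaves room for splitting off one factor in `gauss-ψ` and `jacobi-cube`.
    M : ℕ
    M = suc (suc N ℕ.+ suc N)

    N≤M : N ℕ.≤ M
    N≤M = ℕₚ.≤-trans (ℕₚ.n≤1+n N) (ℕₚ.≤-trans (ℕₚ.m≤m+n (suc N) (suc N)) (ℕₚ.n≤1+n _))

    θ-cong : ∀ {v w} c c′ → (∀ k → v k ≡ w k) → θ v c c′ ≈ θ w c c′
    θ-cong c c′ v≡w = ∑-cong (range (suc N)) λ k → *-congʳ (ι-cong (v≡w k))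

    ι-1* : ∀ z → ι -1ℤ * z ≈ - z
    ι-1* z = solve 1 (λ z → con -1ℤ :* z := :- z) refl z

    jacobi-triple-product : ∀ s (s²≡1 : s ℤ.* s ≡ 1ℤ) c c′ .{{_ : ℕ.NonZero (c ℕ.+ c′)}} →
      θ (λ k → s ℤ.^ ∣ k ∣) c c′ ≈
      (∏ (λ i → 1# + ι s * q ^ (c ℕ.+ (c ℕ.+ c′) ℕ.* i)) M *
       ∏ (λ i → 1# + ι s * q ^ (c′ ℕ.+ (c ℕ.+ c′) ℕ.* i)) M) * E (c ℕ.+ c′)
    jacobi-triple-product s s²≡1 c c′ = begin
      θ (λ k → s ℤ.^ ∣ k ∣) c c′
        ≈⟨ θ-cong c c′ (λ k → ≡.sym (ℤₚ.*-identityˡ (s ℤ.^ ∣ k ∣))) ⟩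
      θ (λ k → 1ℤ ℤ.* s ℤ.^ ∣ k ∣) c c′
        ≈⟨ θ≈weightedSum (λ _ → 1ℤ) M (ℕₚ.n≤1+n _) ⟩
      weightedSum (λ _ → ι 1ℤ) M M * E (c ℕ.+ c′)
        ≈⟨ *-congʳ (trans (weightedSum-cong M M (λ _ → 1-homo)) (finite-triple-product M M)) ⟩
      _ ≈⟨ *-congʳ (*-cong (∏-cong M λ i → +-congˡ (factor c i))
          (∏-cong M λ i → +-congˡ (factor c′ i))) ⟩
      _ ∎
      where open Signed s s²≡1 c c′

    -- The identities of Gauss, Euler and Jacobi

    1-q^ : ∀ {m n} → m ≡ n → 1# + ι -1ℤ * q ^ m ≈ 1# - q ^ n
    1-q^ ≡.refl = +-congˡ (ι-1* _)

    split₂ : ∀ n → ∏ (λ i → 1# + ι -1ℤ * q ^ (1 ℕ.+ 2 ℕ.* i)) n * product 2 n ≈ product 1 (n ℕ.+ n)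
    split₂ zero    = *-identityʳ 1#
    split₂ (suc n) = begin
      ((1# + ι -1ℤ * q ^ (1 ℕ.+ 2 ℕ.* n)) * A) * ((1# - q ^ (2 ℕ.* suc n)) * B)
        ≈⟨ solve 4 (λ u a v b → (u :* a) :* (v :* b) := v :* (u :* (a :* b))) refl _ _ _ _ ⟩
      (1# - q ^ (2 ℕ.* suc n)) * ((1# + ι -1ℤ * q ^ (1 ℕ.+ 2 ℕ.* n)) * (A * B))
        ≈⟨ *-cong (+-congˡ (-‿cong (^-congʳ q (e₁ n)))) (*-cong (1-q^ (e₂ n)) (split₂ n)) ⟩
      product 1 (suc (suc (n ℕ.+ n)))
        ≈⟨ reflexive (≡.cong (product 1 ∘ suc) (≡.sym (ℕₚ.+-suc n n))) ⟩
      product 1 (suc n ℕ.+ suc n) ∎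
      where
      A = ∏ (λ i → 1# + ι -1ℤ * q ^ (1 ℕ.+ 2 ℕ.* i)) n
      B = product 2 n
      e₁ : ∀ n → 2 ℕ.* suc n ≡ 1 ℕ.* suc (suc (n ℕ.+ n))
      e₁ = solve-∀
      e₂ : ∀ n → 1 ℕ.+ 2 ℕ.* n ≡ 1 ℕ.* suc (n ℕ.+ n)
      e₂ = solve-∀

    split₃ : ∀ n → (∏ (λ i → 1# + ι -1ℤ * q ^ (2 ℕ.+ 3 ℕ.* i)) n *
                    ∏ (λ i → 1# + ι -1ℤ * q ^ (1 ℕ.+ 3 ℕ.* i)) n) * product 3 n ≈ product 1
                        (n ℕ.+ (n ℕ.+ n))
    split₃ zero    = trans (*-identityʳ _) (*-identityʳ 1#)
    split₃ (suc n) = begin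
      (((1# + ι -1ℤ * q ^ (2 ℕ.+ 3 ℕ.* n)) * A) * ((1# + ι -1ℤ * q ^ (1 ℕ.+ 3 ℕ.* n)) * B)) *
          ((1# - q ^ (3 ℕ.* suc n)) * C)
        ≈⟨ solve 6 (λ u a v b w c → ((u :* a) :* (v :* b)) :* (w :* c)
            := w :* (u :* (v :* ((a :* b) :* c)))) refl _ _ _ _ _ _ ⟩
      (1# - q ^ (3 ℕ.* suc n)) * ((1# + ι -1ℤ * q ^ (2 ℕ.+ 3 ℕ.* n)) *
          ((1# + ι -1ℤ * q ^ (1 ℕ.+ 3 ℕ.* n)) * ((A * B) * C)))
        ≈⟨ *-cong (+-congˡ (-‿cong (^-congʳ q (e₁ n))))
            (*-cong (1-q^ (e₂ n)) (*-cong (1-q^ (e₃ n)) (split₃ n))) ⟩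
      product 1 (suc (suc (suc (n ℕ.+ (n ℕ.+ n)))))
        ≈⟨ reflexive (≡.cong (product 1) (e₄ n)) ⟩
      product 1 (suc n ℕ.+ (suc n ℕ.+ suc n)) ∎
      where
      A = ∏ (λ i → 1# + ι -1ℤ * q ^ (2 ℕ.+ 3 ℕ.* i)) n
      B = ∏ (λ i → 1# + ι -1ℤ * q ^ (1 ℕ.+ 3 ℕ.* i)) n
      C = product 3 n
      e₁ : ∀ n → 3 ℕ.* suc n ≡ 1 ℕ.* suc (suc (suc (n ℕ.+ (n ℕ.+ n))))
      e₁ = solve-∀
      e₂ : ∀ n → 2 ℕ.+ 3 ℕ.* n ≡ 1 ℕ.* suc (suc (n ℕ.+ (n ℕ.+ n)))
      e₂ = solve-∀
      e₃ : ∀ n → 1 ℕ.+ 3 ℕ.* n ≡ 1 ℕ.* suc (n ℕ.+ (n ℕ.+ n))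
      e₃ = solve-∀
      e₄ : ∀ n → suc (suc (suc (n ℕ.+ (n ℕ.+ n)))) ≡ suc n ℕ.+ (suc n ℕ.+ suc n)
      e₄ = solve-∀

    gauss-φ : θ ε 1 1 * E 2 ≈ E 1 * E 1
    gauss-φ = begin
      θ ε 1 1 * E 2        ≈⟨ *-congʳ (jacobi-triple-product -1ℤ ≡.refl 1 1) ⟩
      ((O * O) * E 2) * E 2
        ≈⟨ solve 2 (λ o e → ((o :* o) :* e) :* e := (o :* e) :* (o :* e)) refl _ _ ⟩
      (O * E 2) * (O * E 2) ≈⟨ *-cong O*E₂ O*E₂ ⟩
      E 1 * E 1             ∎
      where
      O = ∏ (λ i → 1# + ι -1ℤ * q ^ (1 ℕ.+ 2 ℕ.* i)) M
      O*E₂ : O * E 2 ≈ E 1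
      O*E₂ = trans (*-congˡ (sym (product≈E 2 N≤M)))
        (trans (split₂ M) (product≈E 1 (ℕₚ.≤-trans N≤M (ℕₚ.m≤m+n M M))))

    euler : θ ε 2 1 ≈ E 1
    euler = begin
      θ ε 2 1         ≈⟨ jacobi-triple-product -1ℤ ≡.refl 2 1 ⟩
      _ * E 3         ≈⟨ *-congˡ (product≈E 3 N≤M) ⟨
      _ * product 3 M ≈⟨ split₃ M ⟩
      product 1 (M ℕ.+ (M ℕ.+ M)) ≈⟨ product≈E 1 (ℕₚ.≤-trans N≤M (ℕₚ.m≤m+n M (M ℕ.+ M))) ⟩
      E 1             ∎

    ∏[1+q^i] : ℕ → Carrier
    ∏[1+q^i] = ∏ (λ i → 1# + q ^ suc i)

    ∏[1+q^i]-E : ∀ {n} → N ℕ.≤ n → ∏[1+q^i] n * E 1 ≈ E 2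
    ∏[1+q^i]-E {n} N≤n = trans (*-congˡ (sym (product≈E 1 N≤n))) (trans (go n) (product≈E 2 N≤n))
      where
      go : ∀ n → ∏[1+q^i] n * product 1 n ≈ product 2 n
      go zero    = *-identityʳ 1#
      go (suc n) = begin
        ((1# + q ^ suc n) * ∏[1+q^i] n) * ((1# - q ^ (1 ℕ.* suc n)) * product 1 n)
          ≈⟨ *-congˡ (*-congʳ (+-congˡ (-‿cong (^-congʳ q (ℕₚ.*-identityˡ (suc n)))))) ⟩
        ((1# + q ^ suc n) * ∏[1+q^i] n) * ((1# - q ^ suc n) * product 1 n)
          ≈⟨ solve 3 (λ r a b → ((:1 :+ r) :* a) :* ((:1 :- r) :* b) := (:1 :- r :* r) :* (a :* b))
              refl _ _ _ ⟩
        (1# - q ^ suc n * q ^ suc n) * (∏[1+q^i] n * product 1 n)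
          ≈⟨ *-cong (+-congˡ (-‿cong (trans (sym (^-homo-* q (suc n) (suc n)))
               (^-congʳ q (≡.cong (suc n ℕ.+_) (≡.sym (ℕₚ.+-identityʳ (suc n)))))))) (go n) ⟩
        product 2 (suc n) ∎

    -- The terms of index k and −1 − k agree, hence the factor 2.
    gauss-ψ : θ (λ _ → 1ℤ) 1 0 * E 1 ≈ ι (+ 2) * (E 2 * E 2)
    gauss-ψ = begin
      θ (λ _ → 1ℤ) 1 0 * E 1
        ≈⟨ *-congʳ (trans (θ-cong 1 0 (λ k → ≡.sym (ℤₚ.^-zeroˡ ∣ k ∣)))
            (jacobi-triple-product 1ℤ ≡.refl 1 0)) ⟩
      ((_ * _) * E 1) * E 1
        ≈⟨ *-congʳ (*-congʳ (*-cong
             (∏-cong M λ i → +-congˡ (trans (trans (*-congʳ 1-homo) (*-identityˡ _))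
                 (^-congʳ q (≡.cong suc (ℕₚ.*-identityˡ i)))))
             -- As c′ = 0, the second product begins with 1 + q⁰ = 2; its other factors are again
             -- the 1 + q^i.
             (trans (∏-first _ M-1) (*-cong (trans (+-congˡ (*-congʳ 1-homo)) two)
               (∏-cong M-1 λ i → +-congˡ (trans (trans (*-congʳ 1-homo) (*-identityˡ _))
                   (^-congʳ q (ℕₚ.*-identityˡ (suc i))))))))) ⟩
      ((∏[1+q^i] M * (ι (+ 2) * ∏[1+q^i] M-1)) * E 1) * E 1
        ≈⟨ solve 4 (λ a c b e → ((a :* (c :* b)) :* e) :* e := c :* ((a :* e) :* (b :* e)))
            refl _ _ _ _ ⟩
      ι (+ 2) * ((∏[1+q^i] M * E 1) * (∏[1+q^i] M-1 * E 1))
        ≈⟨ *-congˡ (*-cong (∏[1+q^i]-E N≤M) (∏[1+q^i]-E N≤M-1)) ⟩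
      ι (+ 2) * (E 2 * E 2) ∎
      where
      M-1 = suc N ℕ.+ suc N
      N≤M-1 = ℕₚ.≤-trans (ℕₚ.n≤1+n N) (ℕₚ.m≤m+n (suc N) (suc N))
      two : 1# + 1# * 1# ≈ ι (+ 2)
      two = solve 0 (:1 :+ :1 :* :1 := con (+ 2)) refl

    -- For s = -1 and c′ = 0 the triple product has y = -1, where the weights 2 k + 1 extract the
    -- derivative. The terms of index k and -1 - k agree, as both the weight and the sign change;
    -- this is the origin of the 2.
    jacobi-cube : θ (λ k → (+ 2 ℤ.* k ℤ.+ 1ℤ) ℤ.* ε k) 1 0 ≈ ι (+ 2) * (E 1 * E 1 * E 1)
    jacobi-cube = begin
      θ (λ k → (+ 2 ℤ.* k ℤ.+ 1ℤ) ℤ.* ε k) 1 0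
        ≈⟨ θ≈weightedSum (λ k → + 2 ℤ.* k ℤ.+ 1ℤ) M (ℕₚ.n≤1+n _) ⟩
      weightedSum (ν M) M M * E 1
        ≈⟨ *-congʳ (finite-triple-product′ y≈-1 ν diagonal step M M-1) ⟩
      (ι (+ 2) * (_ * _)) * E 1
        ≈⟨ *-congʳ (*-congˡ (*-cong
             (∏-cong M λ i → trans (+-congˡ (factor 1 i)) (1-q^ {suc (i ℕ.+ 0)} ≡.refl))
             (∏-cong M-1 λ i → trans (+-congˡ (factor 0 (suc i))) (1-q^ {suc (i ℕ.+ 0)} ≡.refl)))) ⟩
      (ι (+ 2) * (product 1 M * product 1 M-1)) * E 1
        ≈⟨ *-congʳ (*-congˡ (*-cong (product≈E 1 N≤M) (product≈E 1 N≤M-1))) ⟩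
      (ι (+ 2) * (E 1 * E 1)) * E 1
        ≈⟨ *-assoc _ _ _ ⟩
      ι (+ 2) * (E 1 * E 1 * E 1) ∎
      where
      open Signed -1ℤ ≡.refl 1 0
      M-1 = suc N ℕ.+ suc N
      N≤M-1 = ℕₚ.≤-trans (ℕₚ.n≤1+n N) (ℕₚ.m≤m+n (suc N) (suc N))
      ν : ℕ → ℕ → Carrier
      ν B a = ι (+ 2 ℤ.* (a ⊖ B) ℤ.+ 1ℤ)
      y≈-1 : ι -1ℤ * q ^ 0 ≈ - 1#
      y≈-1 = ι-1* 1#
      diagonal : ∀ B a → ν (suc B) (suc a) ≈ ν B a
      diagonal B a = ι-cong (≡.cong (λ k → + 2 ℤ.* k ℤ.+ 1ℤ) (ℤₚ.[1+m]⊖[1+n]≡m⊖n a B))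
      step : ∀ B a → ν (suc B) a ≈ ν B a + ι (ℤ.- + 2)
      step B a = trans (ι-cong (2[a⊖1+b]+1 a B)) (+-homo _ _)

    -- The series S and T and the congruence modulo 5

    S T : Carrier
    S = θ (λ k → + 6 ℤ.* k ℤ.+ 1ℤ) 2 1
    T = θ ε 1 1

    T₅ : Carrier
    T₅ = ∑ (λ k → ι (ε k) * q ^ (5 ℕ.* exponent 1 1 k)) (range (suc N))

    module _ (2-cancel : ∀ r → ι (+ 2) * r ≈ 0# → r ≈ 0#) where

      2-cancel₂ : ∀ {r s} → ι (+ 2) * r ≈ ι (+ 2) * s → r ≈ s
      2-cancel₂ {r} {s} eq = begin
        r             ≈⟨ solve 2 (λ r s → r := (r :- s) :+ s) refl r s ⟩
        (r - s) + s   ≈⟨ +-congʳ (2-cancel (r - s) (begin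
          ι (+ 2) * (r - s)
            ≈⟨ solve 3 (λ c r s → c :* (r :- s) := c :* r :- c :* s) refl _ _ _ ⟩
          ι (+ 2) * r - ι (+ 2) * s     ≈⟨ +-congʳ eq ⟩
          ι (+ 2) * s - ι (+ 2) * s     ≈⟨ -‿inverseʳ _ ⟩
          0#                            ∎)) ⟩
        0# + s        ≈⟨ +-identityˡ s ⟩
        s             ∎

      θ-rotation : S * θ (λ _ → 1ℤ) 1 0 ≈ θ ε 2 1 * θ (λ k → (+ 2 ℤ.* k ℤ.+ 1ℤ) ℤ.* ε k) 1 0
      θ-rotation = begin
        S * θ (λ _ → 1ℤ) 1 0
          -- The difference of the two sides is rewritten as the single double sum of `F`, which the
          -- involution annihilates.
          ≈⟨ solve 2 (λ s p → s := (s :- p) :+ p) refl _ _ ⟩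
        (S * θ (λ _ → 1ℤ) 1 0 - PJ) + PJ
          ≈⟨ +-congʳ (+-cong (∑-product _ _ K K)
              (trans (-‿cong (∑-product _ _ K K)) (sym (-1*x≈-x _)))) ⟩
        (∑ _ K² + - 1# * ∑ _ K²) + PJ
          ≈⟨ +-congʳ (trans (+-congˡ (sym (∑-*ˡ (- 1#) _ K²))) (sym (∑-+ _ _ K²))) ⟩
        ∑ _ K² + PJ
          ≈⟨ +-congʳ (∑-cong K² combine) ⟩
        ∑ F K² + PJ
          ≈⟨ +-congʳ (∑-involution 2-cancel F rotate rotate-involutive F-rotate K²-unique
              F-support) ⟩
        0# + PJ
          ≈⟨ +-identityˡ _ ⟩
        PJ ∎
        where
        PJ = θ ε 2 1 * θ (λ k → (+ 2 ℤ.* k ℤ.+ 1ℤ) ℤ.* ε k) 1 0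
        K = range (suc N)
        K² = cartesianProduct K K
        F : ℤ × ℤ → Carrier
        F u = ι (rotationWeight u) * q ^ rotationExponent u
        combine : ∀ ((n , j) : ℤ × ℤ) →
          (ι (+ 6 ℤ.* n ℤ.+ 1ℤ) * q ^ exponent 2 1 n) * (ι 1ℤ * q ^ exponent 1 0 j) +
          - 1# * ((ι (ε n) * q ^ exponent 2 1 n) *
              (ι ((+ 2 ℤ.* j ℤ.+ 1ℤ) ℤ.* ε j) * q ^ exponent 1 0 j)) ≈ F (n , j)
        combine (n , j) = sym (begin
          ι (rotationWeight (n , j)) * q ^ rotationExponent (n , j)
            ≈⟨ *-cong (trans (+-homo _ _) (+-congˡ
                (trans (-‿homo _) (-‿cong (trans (*-homo _ _) (*-congʳ (*-homo _ _)))))))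
                      (^-homo-* q (exponent 2 1 n) (exponent 1 0 j)) ⟩
          (ι (+ 6 ℤ.* n ℤ.+ 1ℤ) - (ι (ε n) * ι (ε j)) * ι (+ 2 ℤ.* j ℤ.+ 1ℤ)) *
              (q ^ exponent 2 1 n * q ^ exponent 1 0 j)
            ≈⟨ solve 6 (λ s a b y r r′ → (s :- (a :* b) :* y) :* (r :* r′) :=
                 (s :* r) :* (con 1ℤ :* r′) :+ :- :1 :* ((a :* r) :* ((y :* b) :* r′)))
                     refl _ _ _ _ _ _ ⟩
          (ι (+ 6 ℤ.* n ℤ.+ 1ℤ) * q ^ exponent 2 1 n) * (ι 1ℤ * q ^ exponent 1 0 j) +
          - 1# * ((ι (ε n) * q ^ exponent 2 1 n) *
              ((ι (+ 2 ℤ.* j ℤ.+ 1ℤ) * ι (ε j)) * q ^ exponent 1 0 j))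
            ≈⟨ +-congˡ (*-congˡ (*-congˡ (*-congʳ (sym (*-homo _ _))))) ⟩
          _ ∎)
        F-rotate : ∀ u → F (rotate u) ≈ - F u
        F-rotate u = begin
          ι (rotationWeight (rotate u)) * q ^ rotationExponent (rotate u)
            ≈⟨ *-cong (trans (ι-cong (rotationWeight-rotate u)) (-‿homo _))
                (^-congʳ q (rotationExponent-rotate u)) ⟩
          - ι (rotationWeight u) * q ^ rotationExponent u
            ≈⟨ -‿distribˡ-* _ _ ⟨
          - F u ∎
        K²-unique : Unique K²
        K²-unique = Unique.cartesianProduct⁺ (range-unique (suc N)) (range-unique (suc N))
        F-support : ∀ u → F u ≈ 0# ⊎ u ∈ K²
        F-support u@(n , j) with rotationExponent u ℕₚ.≤? N
        ... | yes e≤N = inj₂ (∈-cartesianProduct⁺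
          (∈-range⁺ (suc N) n (ℕₚ.≤-trans (∣k∣≤1+exponent 2 1 n)
              (ℕ.s≤s (ℕₚ.≤-trans (ℕₚ.m≤m+n _ _) e≤N))))
          (∈-range⁺ (suc N) j (ℕₚ.≤-trans (∣k∣≤1+exponent 1 0 j)
              (ℕ.s≤s (ℕₚ.≤-trans (ℕₚ.m≤n+m _ (exponent 2 1 n)) e≤N)))))
        ... | no  e≰N = inj₁ (trans (*-congˡ (q^-vanish (ℕₚ.≰⇒> e≰N))) (zeroʳ _))

      -- This formula is commonly derived from the quintuple product identity, whence the name. Here
      -- the factors 2 of `gauss-ψ` and `jacobi-cube` cancel against each other.
      quintuple : S * (E 2 * E 2) ≈ E 1 ^ 5
      quintuple = 2-cancel₂ (begin
        ι (+ 2) * (S * (E 2 * E 2))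
          ≈⟨ solve 3 (λ c s e → c :* (s :* e) := s :* (c :* e)) refl _ _ _ ⟩
        S * (ι (+ 2) * (E 2 * E 2))       ≈⟨ *-congˡ gauss-ψ ⟨
        S * (θ (λ _ → 1ℤ) 1 0 * E 1)      ≈⟨ *-assoc _ _ _ ⟨
        (S * θ (λ _ → 1ℤ) 1 0) * E 1      ≈⟨ *-congʳ (trans θ-rotation (*-cong euler jacobi-cube)) ⟩
        (E 1 * (ι (+ 2) * (E 1 * E 1 * E 1))) * E 1
          ≈⟨ solve 2 (λ c e → (e :* (c :* (e :* e :* e))) :* e := c :* e :^ 5) refl _ _ ⟩
        ι (+ 2) * E 1 ^ 5                 ∎)

      T-frobenius : ∃ λ U → T ^ 5 ≈ T₅ + ι (+ 5) * U
      T-frobenius = proj₁ fermat , trans (proj₂ fermat) (+-congʳ (∑-cong (range (suc N)) λ k →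
        trans (^-distrib-* _ _ 5) (*-cong (ι-ε^5 k)
          (trans (^-assocʳ q (exponent 1 1 k) 5) (^-congʳ q (ℕₚ.*-comm (exponent 1 1 k) 5))))))
        where
        fermat = frobenius (λ k → ι (ε k) * q ^ exponent 1 1 k) (range (suc N))

      -- α is f₂² / f₁³, given only by its defining equation. The unit K = f₁³ f₂³ clears all
      -- denominators: f₁³ completes α to f₂², and f₂² f₂³ supplies an f₂ to each factor of T⁵.
      congruence : ∀ α → α * E 1 ^ 3 ≈ E 2 ^ 2 → ∃ λ V → α * T₅ ≈ T * S + ι (+ 5) * V
      congruence α αE₁³≈E₂² = - ((U * E 2 ^ 5) * K′) , unit-cancelʳ K-unit (begin
        (α * T₅) * K
          ≈⟨ solve 4 (λ a t e f → (a :* t) :* (e :* f) := (a :* e) :* (t :* f))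
              refl α T₅ (E 1 ^ 3) (E 2 ^ 3) ⟩
        (α * E 1 ^ 3) * (T₅ * E 2 ^ 3)
          ≈⟨ *-cong αE₁³≈E₂² (*-congʳ T₅≈) ⟩
        E 2 ^ 2 * ((T ^ 5 - ι (+ 5) * U) * E 2 ^ 3)
          ≈⟨ solve 5 (λ f f′ t c u → f :* ((t :- c :* u) :* f′)
              := t :* (f :* f′) :- c :* (u :* (f :* f′)))
               refl (E 2 ^ 2) (E 2 ^ 3) (T ^ 5) (ι (+ 5)) U ⟩
        T ^ 5 * (E 2 ^ 2 * E 2 ^ 3) - ι (+ 5) * (U * (E 2 ^ 2 * E 2 ^ 3))
          ≈⟨ +-cong (*-congˡ E₂⁵) (-‿cong (*-congˡ (*-congˡ E₂⁵))) ⟩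
        T ^ 5 * E 2 ^ 5 - ι (+ 5) * (U * E 2 ^ 5)
          -- The error term is multiplied by `K * K′`, which is 1, so that `K` can be factored out
          -- of both terms and cancelled.
          ≈⟨ +-cong T⁵E₂⁵ (-‿cong (*-congˡ (sym (trans (*-congˡ KK′≈1) (*-identityʳ _))))) ⟩
        (T * S) * K - ι (+ 5) * ((U * E 2 ^ 5) * (K * K′))
          ≈⟨ solve 5 (λ a k c u k′ → a :* k :- c :* (u :* (k :* k′))
              := (a :+ c :* :- (u :* k′)) :* k)
               refl (T * S) K (ι (+ 5)) (U * E 2 ^ 5) K′ ⟩
        (T * S + ι (+ 5) * - ((U * E 2 ^ 5) * K′)) * K ∎)
        where
        K = E 1 ^ 3 * E 2 ^ 3
        U = proj₁ T-frobenius
        unit-^ : ∀ {u} n → Unit u → Unit (u ^ n)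
        unit-^ zero    _ = 1# , *-identityʳ 1#
        unit-^ (suc n) u = unit-* u (unit-^ n u)
        K-unit : Unit K
        K-unit = unit-* (unit-^ 3 (product-unit 1 N)) (unit-^ 3 (product-unit 2 N))
        K′ = proj₁ K-unit
        KK′≈1 : K * K′ ≈ 1#
        KK′≈1 = proj₂ K-unit
        E₂⁵ : E 2 ^ 2 * E 2 ^ 3 ≈ E 2 ^ 5
        E₂⁵ = sym (^-homo-* (E 2) 2 3)
        T₅≈ : T₅ ≈ T ^ 5 - ι (+ 5) * U
        T₅≈ = trans (solve 2 (λ t u → t := (t :+ u) :- u)
            refl T₅ (ι (+ 5) * U)) (+-congʳ (sym (proj₂ T-frobenius)))
        -- Only four of the five factors T f₂ are replaced by f₁², since one T has to remain. Of the
        -- resulting f₁⁸, f₁⁵ turns into S f₂² and f₁³ goes into K.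
        T⁵E₂⁵ : T ^ 5 * E 2 ^ 5 ≈ (T * S) * K
        T⁵E₂⁵ = begin
          T ^ 5 * E 2 ^ 5
            ≈⟨ ^-distrib-* T (E 2) 5 ⟨
          (T * E 2) * (T * E 2) ^ 4
            ≈⟨ *-congˡ (^-congˡ 4 (trans gauss-φ (*-congˡ (sym (*-identityʳ (E 1)))))) ⟩
          (T * E 2) * (E 1 ^ 2) ^ 4
            ≈⟨ *-congˡ (trans (^-assocʳ (E 1) 2 4) (^-homo-* (E 1) 5 3)) ⟩
          (T * E 2) * (E 1 ^ 5 * E 1 ^ 3)
            ≈⟨ *-congˡ (*-congʳ quintuple) ⟨
          (T * E 2) * ((S * (E 2 * E 2)) * E 1 ^ 3)
            ≈⟨ solve 4 (λ t f s e → (t :* f) :* ((s :* (f :* f)) :* e)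
                := (t :* s) :* (e :* (f :* (f :* (f :* :1)))))
                 refl T (E 2) S (E 1 ^ 3) ⟩
          (T * S) * K ∎

-- The ring of integral power series modulo q^(N+1)

module TruncatedPowerSeries where

  open import Defs
  open import Data.Integer.Base using (_+_; _*_; -_)
  open import Data.Integer.Solver using (module +-*-Solver)
  open +-*-Solver using (solve; con; _:=_; _:+_; _:*_)
  open import Level using (0ℓ)
  open import Relation.Nullary.Decidable using (dec-false)
  open ≡

  infixr 7 _·_
  _·_ : ℤ → PowerSeries → PowerSeries
  (c · F) n = c * F n

  infixl 6 _⊕_
  _⊕_ : PowerSeries → PowerSeries → PowerSeries
  (F ⊕ G) n = F n + G n

  𝟘 : PowerSeries
  𝟘 n = 0ℤ

  -- A coefficient of a product involves no higher coefficients of the factors, so equality up to N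
  -- is a congruence.
  ⊛-cong-≤ : ∀ {F F′ G G′} n → (∀ i → i ℕ.≤ n → F i ≡ F′ i) → (∀ i → i ℕ.≤ n → G i ≡ G′ i) →
             (F ⊛ G) n ≡ (F′ ⊛ G′) n
  ⊛-cong-≤ zero    F≡F′ G≡G′ = cong (_+ 0ℤ) (cong₂ _*_ (F≡F′ 0 ℕ.z≤n) (G≡G′ 0 ℕ.z≤n))
  ⊛-cong-≤ (suc n) F≡F′ G≡G′ = cong₂ _+_ (cong₂ _*_ (F≡F′ 0 ℕ.z≤n) (G≡G′ (suc n) ℕₚ.≤-refl))
    (⊛-cong-≤ n (λ i → F≡F′ (suc i) ∘ ℕ.s≤s) (λ i → G≡G′ i ∘ ℕₚ.m≤n⇒m≤1+n))

  ⊛-zeroˡ : ∀ F → 𝟘 ⊛ F ≗ 𝟘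
  ⊛-zeroˡ F zero    = refl
  ⊛-zeroˡ F (suc n) = trans (ℤₚ.+-identityˡ _) (⊛-zeroˡ F n)

  ⊛-identityˡ : ∀ F → 𝟙 ⊛ F ≗ F
  ⊛-identityˡ F zero    = solve 1 (λ a → con 1ℤ :* a :+ con 0ℤ := a) refl (F 0)
  ⊛-identityˡ F (suc n) = trans (cong (_+_ (1ℤ * F (suc n))) (⊛-zeroˡ F n))
    (solve 1 (λ a → con 1ℤ :* a :+ con 0ℤ := a) refl (F (suc n)))

  ·-⊛ : ∀ c F G → (c · F) ⊛ G ≗ c · (F ⊛ G)
  ·-⊛ c F G zero    = solve 3 (λ c f g → (c :* f) :* g :+ con 0ℤ := c :* (f :* g :+ con 0ℤ))
      refl c (F 0) (G 0)
  ·-⊛ c F G (suc n) = trans (cong (_+_ (c * F 0 * G (suc n))) (·-⊛ c (F ∘ suc) G n))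
    (solve 4 (λ c f g h → (c :* f) :* g :+ c :* h := c :* (f :* g :+ h)) refl c (F 0) (G (suc n)) _)

  ⊛-distribʳ : ∀ H F G → (F ⊕ G) ⊛ H ≗ (F ⊛ H) ⊕ (G ⊛ H)
  ⊛-distribʳ H F G zero    = solve 3 (λ f g h → (f :+ g) :* h :+ con 0ℤ
      := (f :* h :+ con 0ℤ) :+ (g :* h :+ con 0ℤ))
    refl (F 0) (G 0) (H 0)
  ⊛-distribʳ H F G (suc n) = trans
      (cong (_+_ ((F 0 + G 0) * H (suc n))) (⊛-distribʳ H (F ∘ suc) (G ∘ suc) n))
    (solve 5 (λ f g h x y → (f :+ g) :* h :+ (x :+ y) := (f :* h :+ x) :+ (g :* h :+ y))
        refl (F 0) (G 0) (H (suc n)) _ _)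

  -- The induction rests on the tail of F ⊛ G, which by computation is F 0 times the tail of G plus
  -- the tail of F times G.
  ⊛-assoc : ∀ F G H → (F ⊛ G) ⊛ H ≗ F ⊛ (G ⊛ H)
  ⊛-assoc F G H zero    = solve 3 (λ f g h → (f :* g :+ con 0ℤ) :* h :+ con 0ℤ
      := f :* (g :* h :+ con 0ℤ) :+ con 0ℤ)
    refl (F 0) (G 0) (H 0)
  ⊛-assoc F G H (suc n) = begin
    (F 0 * G 0 + 0ℤ) * H (suc n) + ((F 0 · (G ∘ suc) ⊕ (F ∘ suc) ⊛ G) ⊛ H) n
      ≡⟨ cong (_+_ ((F 0 * G 0 + 0ℤ) * H (suc n)))
          (trans (⊛-distribʳ H (F 0 · (G ∘ suc)) ((F ∘ suc) ⊛ G) n)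
           (cong₂ _+_ (·-⊛ (F 0) (G ∘ suc) H n) (⊛-assoc (F ∘ suc) G H n))) ⟩
    (F 0 * G 0 + 0ℤ) * H (suc n) + (F 0 * ((G ∘ suc) ⊛ H) n + ((F ∘ suc) ⊛ (G ⊛ H)) n)
      ≡⟨ solve 5 (λ f g h x y → (f :* g :+ con 0ℤ) :* h :+ (f :* x :+ y) := f :* (g :* h :+ x) :+ y)
           refl (F 0) (G 0) (H (suc n)) _ _ ⟩
    F 0 * (G ⊛ H) (suc n) + ((F ∘ suc) ⊛ (G ⊛ H)) n ∎
    where open ≡-Reasoning

  -- By computation a product splits off F 0; commutativity needs the mirror image, which splits off
  -- G 0.
  ⊛-last : ∀ F G n → (F ⊛ G) (suc n) ≡ F (suc n) * G 0 + (F ⊛ (G ∘ suc)) n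
  ⊛-last F G zero    = solve 4 (λ f g f′ g′ → f :* g′ :+ (f′ :* g :+ con 0ℤ)
      := f′ :* g :+ (f :* g′ :+ con 0ℤ))
    refl (F 0) (G 0) (F 1) (G 1)
  ⊛-last F G (suc n) = trans (cong (_+_ (F 0 * G (suc (suc n)))) (⊛-last (F ∘ suc) G n))
    (solve 3 (λ x y z → x :+ (y :+ z) := y :+ (x :+ z))
        refl (F 0 * G (suc (suc n))) (F (suc (suc n)) * G 0) _)

  ⊛-comm : ∀ F G → F ⊛ G ≗ G ⊛ F
  ⊛-comm F G zero    = cong (_+ 0ℤ) (ℤₚ.*-comm (F 0) (G 0))
  ⊛-comm F G (suc n) = trans (cong₂ _+_ (ℤₚ.*-comm (F 0) (G (suc n))) (⊛-comm (F ∘ suc) G n))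
    (sym (⊛-last G F n))

  -- The quotient is taken as a setoid. The carrier still consists of full series, so that the
  -- generating function and the f_m are elements as they stand.
  truncatedPowerSeries : ℕ → CommutativeRing 0ℓ 0ℓ
  truncatedPowerSeries N = record
    { Carrier = PowerSeries
    ; _≈_ = λ F G → ∀ i → i ℕ.≤ N → F i ≡ G i
    ; _+_ = _⊕_
    ; _*_ = _⊛_
    ; -_ = λ F n → - F n
    ; 0# = 𝟘
    ; 1# = 𝟙
    ; isCommutativeRing = record
      { isRing = record
        { +-isAbelianGroup = record
          { isGroup = record
            { isMonoid = record
              { isSemigroup = record
                { isMagma = record
                  { isEquivalence = record
                    { refl  = λ _ _ → refl
                    ; sym   = λ F≈G i i≤N → sym (F≈G i i≤N)
                    ; trans = λ F≈G G≈H i i≤N → trans (F≈G i i≤N) (G≈H i i≤N)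
                    }
                  ; ∙-cong = λ F≈F′ G≈G′ i i≤N → cong₂ _+_ (F≈F′ i i≤N) (G≈G′ i i≤N)
                  }
                ; assoc = λ F G H i _ → ℤₚ.+-assoc (F i) (G i) (H i)
                }
              ; identity = (λ F i _ → ℤₚ.+-identityˡ (F i)) , (λ F i _ → ℤₚ.+-identityʳ (F i))
              }
            ; inverse = (λ F i _ → ℤₚ.+-inverseˡ (F i)) , (λ F i _ → ℤₚ.+-inverseʳ (F i))
            ; ⁻¹-cong = λ F≈G i i≤N → cong -_ (F≈G i i≤N)
            }
          ; comm = λ F G i _ → ℤₚ.+-comm (F i) (G i)
          }
        ; *-cong = λ F≈F′ G≈G′ i i≤N → ⊛-cong-≤ i (λ j j≤i → F≈F′ j (ℕₚ.≤-trans j≤i i≤N))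
                                                  (λ j j≤i → G≈G′ j (ℕₚ.≤-trans j≤i i≤N))
        ; *-assoc = λ F G H i _ → ⊛-assoc F G H i
        ; *-identity = (λ F i _ → ⊛-identityˡ F i) ,
            (λ F i _ → trans (⊛-comm F 𝟙 i) (⊛-identityˡ F i))
        ; distrib = (λ F G H i _ → trans (⊛-comm F (G ⊕ H) i)
                      (trans (⊛-distribʳ F G H i) (cong₂ _+_ (⊛-comm G F i) (⊛-comm H F i))))
                  , (λ F G H i _ → ⊛-distribʳ F G H i)
        }
      ; *-comm = λ F G i _ → ⊛-comm F G i
      }
    }

  constant : ∀ N → ℤ.+-*-rawRing -Raw-AlmostCommutative⟶ fromCommutativeRing
      (truncatedPowerSeries N)
  constant N = record
    { ⟦_⟧    = _· 𝟙
    ; +-homo = λ c d i _ → ℤₚ.*-distribʳ-+ (𝟙 i) c d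
    ; *-homo = λ c d i _ → sym (trans (·-⊛ c 𝟙 (d · 𝟙) i)
                 (trans (cong (c *_) (⊛-identityˡ (d · 𝟙) i)) (sym (ℤₚ.*-assoc c d (𝟙 i)))))
    ; -‿homo = λ c i _ → sym (ℤₚ.neg-distribˡ-* c (𝟙 i))
    ; 0-homo = λ _ _ → refl
    ; 1-homo = λ i _ → ℤₚ.*-identityˡ (𝟙 i)
    }

  constant-⊛ : ∀ c F → (c · 𝟙) ⊛ F ≗ c · F
  constant-⊛ c F n = trans (·-⊛ c 𝟙 F n) (cong (c *_) (⊛-identityˡ F n))

  q⊛-suc : ∀ F n → ((q^ 1) ⊛ F) (suc n) ≡ F n
  q⊛-suc F n = trans (ℤₚ.+-identityˡ _) (⊛-identityˡ F n)

  q^-≢ : ∀ d n → d ≢ n → (q^ d) n ≡ 0ℤ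
  q^-≢ d n d≢n rewrite dec-false (d ℕₚ.≟ n) d≢n = refl

  -- Multiplication by q^m shifts the coefficients, and the zeros that it brings in below q^m are
  -- the values of `a` at negative integers.
  q^⊛-generatingFunction : ∀ m n → ((q^ m) ⊛ generatingFunction) n ≡ a (n ⊖ m)
  q^⊛-generatingFunction zero    n       = ⊛-identityˡ generatingFunction n
  q^⊛-generatingFunction (suc m) zero    = refl
  q^⊛-generatingFunction (suc m) (suc n) = trans (ℤₚ.+-identityˡ _)
    (trans (q^⊛-generatingFunction m n) (cong a (sym (ℤₚ.[1+m]⊖[1+n]≡m⊖n n m))))

-- The sum of the theorem as a coefficient of q^N

module Coefficients (N : ℕ) where

  open import Defs
  open import Algebra.Properties.Monoid.Sum ℤₚ.+-0-monoid using (sum-syntax; sum-cong-≗)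
  import Algebra.Properties.Semiring.Exp
  open import Data.Fin.Base using (toℕ)
  open import Data.Integer.Base using (_+_; _*_; _-_; -_)
  open import Data.Integer.Divisibility using (_∣_)
  open import Data.Integer.Solver using (module +-*-Solver)
  open +-*-Solver using (solve; con; _:=_; _:+_; _:*_)
  import Data.Nat.Divisibility as ℕ∣
  open Exponents
  open TruncatedPowerSeries
  open ≡

  private
    module R = CommutativeRing (truncatedPowerSeries N)

  open Algebra.Properties.Semiring.Exp R.semiring using (_^_; ^-congˡ; ^-homo-*)

  q : PowerSeries
  q = q^ 1

  q^-power : ∀ d i → (q ^ d) i ≡ (q^ d) i
  q^-power zero    i       = refl
  q^-power (suc d) zero    = refl
  q^-power (suc d) (suc i) = trans (q⊛-suc (q ^ d) i) (q^-power d i)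

  q^1+N≈0 : q ^ suc N R.≈ 𝟘
  q^1+N≈0 i i≤N = trans (q^-power (suc N) i) (q^-≢ (suc N) i (ℕₚ.>⇒≢ (ℕ.s≤s i≤N)))

  open ThetaIdentities (truncatedPowerSeries N) (constant N)
  open Nilpotent q N q^1+N≈0

  2-cancel : ∀ F → (+ 2 · 𝟙) ⊛ F R.≈ 𝟘 → F R.≈ 𝟘
  2-cancel F 2F≈0 i i≤N = ℤₚ.*-cancelˡ-≡ (+ 2) (F i) 0ℤ
      (trans (sym (constant-⊛ (+ 2) F i)) (2F≈0 i i≤N))

  product≗partialProduct : ∀ d m → product d m ≗ partialProduct d m
  product≗partialProduct d zero    i = refl
  product≗partialProduct d (suc m) i = ⊛-cong-≤ i
    (λ j _ → cong (λ c → 𝟙 j - c) (q^-power (d ℕ.* suc m) j)) (λ j _ → product≗partialProduct d m j)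

  E≈f : ∀ d .{{_ : ℕ.NonZero d}} → E d R.≈ f d
  E≈f d i i≤N = trans (product≗partialProduct d N i)
    (trans (cong (λ m → partialProduct d m i) (sym (ℕₚ.m∸n+n≡m i≤N)))
        (partialProduct-stable d i (N ℕ.∸ i)))

  generatingFunction-E : generatingFunction ⊛ E 1 ^ 3 R.≈ E 2 ^ 2
  generatingFunction-E = begin
    generatingFunction ⊛ E 1 ^ 3
      ≈⟨ R.*-congˡ {generatingFunction} (^-congˡ 3 (E≈f 1)) ⟩
    (f 2 ^ˢ 2 ⊛ (f 1 ^ˢ 3) ⁻¹) ⊛ f 1 ^ˢ 3       ≈⟨ R.*-assoc (f 2 ^ˢ 2) ((f 1 ^ˢ 3) ⁻¹) (f 1 ^ˢ 3) ⟩
    f 2 ^ˢ 2 ⊛ ((f 1 ^ˢ 3) ⁻¹ ⊛ f 1 ^ˢ 3)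
      ≈⟨ R.*-congˡ {f 2 ^ˢ 2} (R.trans (R.*-comm ((f 1 ^ˢ 3) ⁻¹) (f 1 ^ˢ 3))
          (λ i _ → f₁³-invertible i)) ⟩
    f 2 ^ˢ 2 ⊛ 𝟙                               ≈⟨ R.*-identityʳ (f 2 ^ˢ 2) ⟩
    f 2 ^ˢ 2                                   ≈⟨ ^-congˡ 2 (E≈f 2) ⟨
    E 2 ^ 2                                    ∎
    where open import Relation.Binary.Reasoning.Setoid R.setoid

  main : ∃ λ V → generatingFunction ⊛ T₅ R.≈ (T ⊛ S) ⊕ ((+ 5 · 𝟙) ⊛ V)
  main = congruence 2-cancel generatingFunction generatingFunction-E

  ∑-coefficient-zero : ∀ {A : Set} (g : A → PowerSeries) L n → (∀ x → g x n ≡ 0ℤ) → ∑ g L n ≡ 0ℤ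
  ∑-coefficient-zero g []      n g≡0 = refl
  ∑-coefficient-zero g (x ∷ L) n g≡0 = cong₂ _+_ (g≡0 x) (∑-coefficient-zero g L n g≡0)

  sum-last : ∀ (h : ℕ → ℤ) K → ∑[ j < suc K ] h (toℕ j) ≡ ∑[ j < K ] h (toℕ j) + h K
  sum-last h zero    = ℤₚ.+-comm (h 0) 0ℤ
  sum-last h (suc K) = trans (cong (_+_ (h 0)) (sum-last (h ∘ suc) K)) (sym (ℤₚ.+-assoc (h 0) _ _))

  ∑-range-coefficient : ∀ (g : ℤ → PowerSeries) K n →
    ∑ g (range K) n ≡ g 0ℤ n + ∑[ j < K ] (g (+ suc (toℕ j)) n + g -[1+ toℕ j ] n)
  ∑-range-coefficient g zero    n = refl
  ∑-range-coefficient g (suc K) n = begin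
    g (+ suc K) n + (g -[1+ K ] n + ∑ g (range K) n)
      ≡⟨ cong (λ s → g (+ suc K) n + (g -[1+ K ] n + s)) (∑-range-coefficient g K n) ⟩
    g (+ suc K) n + (g -[1+ K ] n + (g 0ℤ n + ∑[ j < K ] h (toℕ j)))
      ≡⟨ solve 4 (λ x y z s → x :+ (y :+ (z :+ s)) := z :+ (s :+ (x :+ y)))
          refl (g (+ suc K) n) (g -[1+ K ] n) (g 0ℤ n) _ ⟩
    g 0ℤ n + (∑[ j < K ] h (toℕ j) + h K)
      ≡⟨ cong (_+_ (g 0ℤ n)) (sum-last h K) ⟨
    g 0ℤ n + ∑[ j < suc K ] h (toℕ j) ∎
    where
    open ≡-Reasoning
    h : ℕ → ℤ
    h j = g (+ suc j) n + g -[1+ j ] n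

  monomial : ∀ F c m n → (F ⊛ ((c · 𝟙) ⊛ q ^ m)) n ≡ c * ((q ^ m) ⊛ F) n
  monomial F c m n = trans (⊛-comm F ((c · 𝟙) ⊛ q ^ m) n)
    (trans (⊛-assoc (c · 𝟙) (q ^ m) F n) (constant-⊛ c ((q ^ m) ⊛ F) n))

  T⊛S-vanish : (∀ k n → exponent 1 1 k ℕ.+ exponent 2 1 n ≢ N) → (T ⊛ S) N ≡ 0ℤ
  T⊛S-vanish not-N = trans (∑-product t s K K N ℕₚ.≤-refl)
      (∑-coefficient-zero (λ (k , n) → t k ⊛ s n) (cartesianProduct K K) N vanish)
    where
    K = range (suc N)
    t s : ℤ → PowerSeries
    t k = (ε k · 𝟙) ⊛ q ^ exponent 1 1 k
    s n = ((+ 6 * n + 1ℤ) · 𝟙) ⊛ q ^ exponent 2 1 n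
    vanish : ∀ ((k , n) : ℤ × ℤ) → (t k ⊛ s n) N ≡ 0ℤ
    vanish (k , n) = begin
      (t k ⊛ s n) N
        ≡⟨ monomial (t k) w e′ N ⟩
      w * ((q ^ e′) ⊛ t k) N
        ≡⟨ cong (w *_) (monomial (q ^ e′) (ε k) e N) ⟩
      w * (ε k * ((q ^ e) ⊛ q ^ e′) N)
        ≡⟨ cong (λ c → w * (ε k * c)) (trans (sym (^-homo-* q e e′ N ℕₚ.≤-refl))
            (trans (q^-power (e ℕ.+ e′) N) (q^-≢ _ N (not-N k n)))) ⟩
      w * (ε k * 0ℤ)
        ≡⟨ trans (cong (w *_) (ℤₚ.*-zeroʳ (ε k))) (ℤₚ.*-zeroʳ w) ⟩
      0ℤ ∎
      where
      open ≡-Reasoning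
      w = + 6 * n + 1ℤ
      e = exponent 1 1 k
      e′ = exponent 2 1 n

  5e≡5k² : ∀ k → + (5 ℕ.* exponent 1 1 k) ≡ + 5 * k ℤ.^ 2
  5e≡5k² k = trans (ℤₚ.pos-* 5 (exponent 1 1 k))
      (cong (+ 5 *_) (ℤₚ.*-cancelˡ-≡ (+ 2) (+ exponent 1 1 k) (k ℤ.^ 2) (trans (2*-exponent 1 1 k)
    (solve 1 (λ k → con (+ 2) :* (k :* k) :+ con 0ℤ :* k := con (+ 2) :* (k :* (k :* con 1ℤ)))
        refl k))))

  summand-coefficient : ∀ k → (generatingFunction ⊛ ((ε k · 𝟙) ⊛ q ^ (5 ℕ.* exponent 1 1 k))) N
      ≡ summand N k
  summand-coefficient k = begin
    (generatingFunction ⊛ ((ε k · 𝟙) ⊛ q ^ m)) N   ≡⟨ monomial generatingFunction (ε k) m N ⟩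
    ε k * ((q ^ m) ⊛ generatingFunction) N
      ≡⟨ cong (ε k *_) (⊛-cong-≤ {G = generatingFunction} {G′ = generatingFunction} N
          (λ i _ → q^-power m i) (λ _ _ → refl)) ⟩
    ε k * ((q^ m) ⊛ generatingFunction) N          ≡⟨ cong (ε k *_) (q^⊛-generatingFunction m N) ⟩
    ε k * a (N ⊖ m)                                ≡⟨ cong (λ i → ε k * a i) (ℤₚ.m-n≡m⊖n N m) ⟨
    ε k * a (+ N - + m)                            ≡⟨ cong (λ i → ε k * a (+ N - i)) (5e≡5k² k) ⟩
    summand N k                                    ∎
    where
    open ≡-Reasoning
    m = 5 ℕ.* exponent 1 1 k

  ∑ℤ-summand : ∑ℤ (summand N) (summand-finiteSupport N) ≡ (generatingFunction ⊛ T₅) N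
  ∑ℤ-summand = sym (begin
    (generatingFunction ⊛ T₅) N
      ≡⟨ ∑-*ˡ generatingFunction (λ k → (ε k · 𝟙) ⊛ q ^ (5 ℕ.* exponent 1 1 k)) (range (suc N)) N
          ℕₚ.≤-refl ⟨
    g (+ suc N) N + (g -[1+ N ] N + ∑ g (range N) N)
      -- `T₅` also has the indices N + 1 and -(N + 1), which `∑ℤ` omits; their summands vanish.
      ≡⟨ cong₂ (λ x y → x + (y + ∑ g (range N) N)) (outside (+ suc N) ℕₚ.≤-refl)
          (outside -[1+ N ] ℕₚ.≤-refl) ⟩
    0ℤ + (0ℤ + ∑ g (range N) N)
      ≡⟨ trans (ℤₚ.+-identityˡ _) (ℤₚ.+-identityˡ _) ⟩
    ∑ g (range N) N
      ≡⟨ ∑-range-coefficient g N N ⟩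
    g 0ℤ N + ∑[ j < N ] (g (+ suc (toℕ j)) N + g -[1+ toℕ j ] N)
      ≡⟨ cong₂ _+_ (summand-coefficient 0ℤ) (sum-cong-≗ {N} λ j →
           cong₂ _+_ (summand-coefficient (+ suc (toℕ j))) (summand-coefficient -[1+ toℕ j ])) ⟩
    ∑ℤ (summand N) (summand-finiteSupport N) ∎)
    where
    open ≡-Reasoning
    g : ℤ → PowerSeries
    g k = generatingFunction ⊛ ((ε k · 𝟙) ⊛ q ^ (5 ℕ.* exponent 1 1 k))
    outside : ∀ k → N ℕ.< ∣ k ∣ → g k N ≡ 0ℤ
    outside k N<∣k∣ = trans (summand-coefficient k) (proj₂ (summand-finiteSupport N) k N<∣k∣)

  5∣∑ℤ : (∀ k n → exponent 1 1 k ℕ.+ exponent 2 1 n ≢ N)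
      → + 5 ∣ ∑ℤ (summand N) (summand-finiteSupport N)
  5∣∑ℤ not-N = subst (ℕ∣._∣_ 5) (sym (trans (cong ∣_∣ ∑≡5V) (ℤₚ.abs-* (+ 5) (V N))))
      (ℕ∣.m∣m*n ∣ V N ∣)
    where
    V = proj₁ main
    ∑≡5V : ∑ℤ (summand N) (summand-finiteSupport N) ≡ + 5 * V N
    ∑≡5V = trans ∑ℤ-summand (trans (proj₂ main N ℕₚ.≤-refl)
      (trans (cong₂ _+_ (T⊛S-vanish not-N) (constant-⊛ (+ 5) V N)) (ℤₚ.+-identityˡ _)))

-- The index of the theorem

open import Defs
open import Data.Nat using (ℕ; _+_; _*_; _∸_; _^_; _/_; _%_; _≤_)
open import Data.Nat.Primality using (Prime)
open import Data.Integer using (+_)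
open import Data.Integer.Divisibility using (_∣_)
open import Data.Sum using (_⊎_)
open import Relation.Binary.PropositionalEquality using (_≡_)

open import Data.Nat.DivMod using (%-distribˡ-*; m≡m%n+[m/n]*n; m*n/n≡m)
open import Data.Nat.Tactic.RingSolver using (solve-∀)
open import Data.Nat.Primality using (prime⇒nonZero)
open NonResidue using (Inert; not-represented)
open Exponents using (exponents-norm)

square : ∀ p → p ^ 2 ≡ p * p
square p = ≡.cong (λ c → p * c) (ℕₚ.*-identityʳ p)

inert-square : ∀ p → Inert (p % 24) → p ^ 2 % 24 ≡ 1
inert-square p inert = ≡.trans (≡.cong (λ c → c % 24) (square p))
    (≡.trans (%-distribˡ-* p p 24) (go inert))
  where
  go : Inert (p % 24) → (p % 24) * (p % 24) % 24 ≡ 1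
  go (inj₁ eq)               rewrite eq = ≡.refl
  go (inj₂ (inj₁ eq))        rewrite eq = ≡.refl
  go (inj₂ (inj₂ (inj₁ eq))) rewrite eq = ≡.refl
  go (inj₂ (inj₂ (inj₂ eq))) rewrite eq = ≡.refl

-- As p is prime to 6, 25 p² ≡ 1 modulo 24, so neither the division nor the subtraction truncates.
24*[25p²∸1]/24+1 : ∀ p → Inert (p % 24) → 24 * ((25 * p ^ 2 ∸ 1) / 24) + 1 ≡ 25 * p ^ 2
24*[25p²∸1]/24+1 p inert = begin
  24 * ((m ∸ 1) / 24) + 1     ≡⟨ ≡.cong (λ c → 24 * ((c ∸ 1) / 24) + 1) m≡1+24k ⟩
  24 * (k * 24 / 24) + 1      ≡⟨ ≡.cong (λ c → 24 * c + 1) (m*n/n≡m k 24) ⟩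
  24 * k + 1                  ≡⟨ ℕₚ.+-comm (24 * k) 1 ⟩
  1 + 24 * k                  ≡⟨ ≡.cong suc (ℕₚ.*-comm 24 k) ⟩
  1 + k * 24                  ≡⟨ m≡1+24k ⟨
  m                           ∎
  where
  open ≡.≡-Reasoning
  m = 25 * p ^ 2
  k = m / 24
  m≡1+24k : m ≡ 1 + k * 24
  m≡1+24k = ≡.trans (m≡m%n+[m/n]*n m 24) (≡.cong (λ c → c + k * 24)
    (≡.trans (%-distribˡ-* 25 (p ^ 2) 24) (≡.cong (λ c → 1 * c % 24) (inert-square p inert))))

theorem1p6 : (p : ℕ) → Prime p →
    (p % 24 ≡ 13) ⊎ (p % 24 ≡ 17) ⊎ (p % 24 ≡ 19) ⊎ (p % 24 ≡ 23) →
    (n r : ℕ) → 1 ≤ r → r ≤ p ∸ 1 →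
    let N = 5 * p ^ 2 * n + 5 * p * r + (25 * p ^ 2 ∸ 1) / 24
    in + 5 ∣ ∑ℤ (summand N) (summand-finiteSupport N)
theorem1p6 p p-prime inert n r 1≤r r≤p-1 = Coefficients.5∣∑ℤ N λ k m e≡N →
  not-represented p p-prime inert n r 1≤r r<p ∣ + 6 ℤ.* m ℤ.+ 1ℤ ∣ ∣ k ∣
    (≡.trans (≡.sym 24N+1) (≡.trans (≡.cong (λ c → 24 * c + 1) (≡.sym e≡N)) (exponents-norm k m)))
  where
  h = (25 * p ^ 2 ∸ 1) / 24
  N = 5 * p ^ 2 * n + 5 * p * r + h
  r<p : r ℕ.< p
  r<p = ℕₚ.m≤pred[n]⇒suc[m]≤n {{prime⇒nonZero p-prime}} r≤p-1
  24N+1 : 24 * N + 1 ≡ 120 * (p * p) * n + 120 * p * r + 25 * (p * p)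
  24N+1 = begin
    24 * N + 1
      ≡⟨ expand p (p ^ 2) n r h ⟩
    120 * p ^ 2 * n + 120 * p * r + (24 * h + 1)
      ≡⟨ ≡.cong (λ c → 120 * p ^ 2 * n + 120 * p * r + c) (24*[25p²∸1]/24+1 p inert) ⟩
    120 * p ^ 2 * n + 120 * p * r + 25 * p ^ 2
      ≡⟨ ≡.cong (λ s → 120 * s * n + 120 * p * r + 25 * s) (square p) ⟩
    120 * (p * p) * n + 120 * p * r + 25 * (p * p) ∎
    where
    open ≡.≡-Reasoning
    expand : ∀ p s n r h → 24 * (5 * s * n + 5 * p * r + h) + 1 ≡
             120 * s * n + 120 * p * r + (24 * h + 1)
    expand = solve-∀
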